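{- Let $n\geq 0$ be an integer and let $x$ be a complex number for which every denominator and every base raised to a negative power below is nonzero (this is the case whenever $x\notin\{0,\pm1,\pm\tfrac{1}{\sqrt2},\pm 2i,\pm i\sqrt2\}$). Then the following twelve identities hold: (1) $\displaystyle\sum_{k=0}^{n-1}\binom{n}{k}\Bigl(\frac{\sqrt{x^2+4}(2x^2-1)}{x}\Bigr)^{n-k-1}\bigl(1-(-1)^{n-k}\bigr)T_{2k}(x)=\sum_{k=1}^{n}\binom{n}{k}\Bigl(\frac{4x^2-2}{x}\Bigr)^{k-1}\bigl(2x\sqrt{x^2-1}\bigr)^{n-k}\bigl(1+(-1)^{n-k}\bigr)F_{k}(x)$; (2) $\displaystyle\sum_{k=0}^{n}\binom{n}{k}\Bigl(\frac{\sqrt{x^2+4}(2x^2-1)}{x}\Bigr)^{n-k-1}\bigl(1-(-1)^{n-k}\bigr)U_{2k}(x)=2x\sum_{k=1}^{n}\binom{n}{k}\Bigl(\frac{4x^2-2}{x}\Bigr)^{k-1}\bigl(2x\sqrt{x^2-1}\bigr)^{n-k-1}\bigl(\alpha(x)-(-1)^{n-k}\beta(x)\bigr)F_{k}(x)$; (3) $\displaystyle\sum_{k=0}^{n}\binom{n}{k}\Bigl(\frac{\sqrt{x^2+4}(2x^2-1)}{x}\Bigr)^{n-k-1}\bigl(1-(-1)^{n-k}\bigr)T_{2k+1}(x)=\sum_{k=1}^{n}\binom{n}{k}\Bigl(\frac{4x^2-2}{x}\Bigr)^{k-1}\bigl(2x\sqrt{x^2-1}\bigr)^{n-k}\bigl(\alpha(x)+(-1)^{n-k}\beta(x)\bigr)F_{k}(x)$;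 (4) $\displaystyle\sum_{k=0}^{n}\binom{n}{k}\Bigl(\frac{\sqrt{x^2+4}(2x^2-1)}{x}\Bigr)^{n-k-1}\bigl(1-(-1)^{n-k}\bigr)U_{2k+1}(x)=2x\sum_{k=1}^{n}\binom{n}{k} \Bigl(\frac{4x^2-2}{x}\Bigr)^{k-1}\bigl(2x\sqrt{x^2-1}\bigr)^{n-k-1}\bigl(\alpha^2(x)-(-1)^{n-k}\beta^2(x)\bigr)F_{k}(x)$; (5) $\displaystyle x\sum_{k=0}^{n}\binom{n}{k}\Bigl(\frac{x^2+2}{2x}\Bigr)^k \Bigl(\frac{x\sqrt{x^2+4}}{2}\Bigr)^{n-k-1}\bigl(\rho(x)-(-1)^{n-k}\sigma(x)\bigr)T_{k}(x)=\sum_{k=0}^{n}\binom{n}{k}\Bigl(\frac{(x^2+2)\sqrt{x^2-1}}{2x}\Bigr)^{n-k}\bigl(1+(-1)^{n-k}\bigr)F_{2k+1}(x)$; (6) $\displaystyle x\sum_{k=0}^{n}\binom{n}{k}\Bigl(\frac{x^2+2}{2x}\Bigr)^{k-1}\Bigl(\frac{x\sqrt{x^2+4}}{2}\Bigr)^{n-k-1}\bigl(\rho(x)-(-1)^{n-k}\sigma(x)\bigr)U_{k}(x)=\sum_{k=0}^{n}\binom{n}{k} \Bigl(\frac{(x^2+2)\sqrt{x^2-1}}{2x}\Bigr)^{n-k-1}\bigl(\alpha(x)-(-1)^{n-k}\beta(x)\bigr)F_{2k+1}(x)$; (7) $\displaystyle x\sum_{k=0}^{n}\binom{n}{k}\Bigl(\frac{x^2+2}{2x}\Bigr)^k\Bigl(\frac{x\sqrt{x^2+4}}{2}\Bigr)^{n-k-1}\bigl(1-(-1)^{n-k}\bigr)T_{k}(x)=\sum_{k=1}^{n}\binom{n}{k}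 \Bigl(\frac{(x^2+2)\sqrt{x^2-1}}{2x}\Bigr)^{n-k}\bigl(1+(-1)^{n-k}\bigr)F_{2k}(x)$; (8) $\displaystyle x\sum_{k=0}^{n}\binom{n}{k} \Bigl(\frac{x^2+2}{2x}\Bigr)^{k-1}\Bigl(\frac{x\sqrt{x^2+4}}{2}\Bigr)^{n-k-1}\bigl(1-(-1)^{n-k}\bigr)U_{k}(x)=\sum_{k=0}^{n}\binom{n}{k} \Bigl(\frac{(x^2+2)\sqrt{x^2-1}}{2x}\Bigr)^{n-k-1} \bigl(\alpha(x)-(-1)^{n-k}\beta(x)\bigr)F_{2k}(x)$; (9) $\displaystyle x\sum_{k=0}^{n}\binom{n}{k} \Bigl(\frac{x^2+2}{4x^2-2}\Bigr)^{k}\Bigl(\frac{x\sqrt{x^2+4}}{2}\Bigr)^{n-k-1}\bigl(1-(-1)^{n-k}\bigr)T_{2k+1}(x)=\sum_{k=0}^{n}\binom{n}{k}\Bigl(\frac{x(x^2+2)\sqrt{x^2-1}}{2x^2-1}\Bigr)^{n-k} \bigl(\alpha(x)+(-1)^{n-k}\beta(x)\bigr)F_{2k}(x)$; (10) $\displaystyle \sum_{k=0}^{n}\binom{n}{k} \Bigl(\frac{x^2+2}{4x^2-2}\Bigr)^{k-1}\Bigl(\frac{x\sqrt{x^2+4}}{2}\Bigr)^{n-k-1}\bigl(1-(-1)^{n-k}\bigr)U_{2k+1}(x)=2\sum_{k=0}^{n}\binom{n}{k} \Bigl(\frac{x(x^2+2)\sqrt{x^2-1}}{2x^2-1}\Bigr)^{n-k-1}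 \bigl(\alpha^2(x)-(-1)^{n-k}\beta^2(x)\bigr)F_{2k}(x)$; (11) $\displaystyle x\sum_{k=0}^{n}\binom{n}{k}\Bigl(\frac{x^2+2}{4x^2-2}\Bigr)^{k}\Bigl(\frac{x\sqrt{x^2+4}}{2}\Bigr)^{n-k-1}\bigl(\rho(x)-(-1)^{n-k}\sigma(x)\bigr)T_{2k}(x)=\sum_{k=0}^{n}\binom{n}{k} \Bigl(\frac{x(x^2+2)\sqrt{x^2-1}}{2x^2-1}\Bigr)^{n-k} \bigl(1+(-1)^{n-k}\bigr)F_{2k+1}(x)$; (12) $\displaystyle \sum_{k=0}^{n}\binom{n}{k} \Bigl(\frac{x^2+2}{4x^2-2}\Bigr)^{k-1}\Bigl(\frac{x\sqrt{x^2+4}}{2}\Bigr)^{n-k-1}\bigl(\rho(x)-(-1)^{n-k}\sigma(x)\bigr)U_{2k}(x)=2\sum_{k=0}^{n}\binom{n}{k} \Bigl(\frac{x(x^2+2)\sqrt{x^2-1}}{2x^2-1}\Bigr)^{n-k-1} \bigl(\alpha(x)-(-1)^{n-k}\beta(x)\bigr)F_{2k+1}(x)$.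
   Context: The Chebyshev polynomials of the first kind $T_n(x)$ and of the second kind $U_n(x)$ are defined by $T_0(x)=1$, $T_1(x)=x$, $T_{n+1}(x)=2xT_n(x)-T_{n-1}(x)$, and $U_0(x)=1$, $U_1(x)=2x$, $U_{n+1}(x)=2xU_n(x)-U_{n-1}(x)$ for $n\ge 1$. The (Catalan) Fibonacci polynomials $F_n(x)$ are defined by $F_0(x)=0$, $F_1(x)=1$, $F_n(x)=xF_{n-1}(x)+F_{n-2}(x)$ for $n\geq 2$. Put $\alpha(x)=x+\sqrt{x^2-1}$, $\beta(x)=x-\sqrt{x^2-1}$, $\rho(x)=\frac{x+\sqrt{x^2+4}}{2}$, $\sigma(x)=\frac{x-\sqrt{x^2+4}}{2}$; $\alpha^2(x)=(\alpha(x))^2$ and $\beta^2(x)=(\beta(x))^2$. Here $\sqrt{x^2-1}$ and $\sqrt{x^2+4}$ denote fixed complex square roots, the same choice being used throughout. Conventions: $0^0=1$, and a sum whose upper limit is smaller than its lower limit is $0$. -}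

module Defs where

open import Algebra.Apartness.Bundles using (HeytingCommutativeRing; HeytingField)
open import Algebra.Apartness.Structures using (IsHeytingField)
open import Algebra.Bundles using (CommutativeRing; Semiring)
open import Algebra.Definitions using (Invertible)
open import Algebra.Structures using (IsCommutativeRing)
open import Data.Fin.Base using (toℕ)
open import Data.Integer.Base as ℤ using (ℤ; +_; -[1+_])
open import Data.Nat.Base as ℕ using (ℕ; zero; suc)
import Data.Nat.Properties as ℕ
open import Data.Product.Base using (∃; _×_; _,_; proj₁; proj₂)
open import Data.Rational.Base as ℚ using (ℚ; 0ℚ; 1ℚ; ½)
import Data.Rational.Properties as ℚ
open import Data.Rational.Solver using (module +-*-Solver)
open import Data.Sum.Base using (_⊎_; inj₁; inj₂; [_,_]′)
open import Level using (0ℓ)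
open import Relation.Binary.Definitions using (Cotransitive; Tight)
open import Relation.Binary.PropositionalEquality
  using (_≡_; _≢_; refl; sym; trans; cong; cong₂; subst; subst₂)
open import Relation.Nullary using (¬_; yes; no; contradiction)

module Sequences where

  open import Data.Rational.Base using (_+_; _*_; _-_; -_; ∣_∣; _<_; _≤_)
  open +-*-Solver using (solve; _:=_; _:+_; _:*_; _:-_; :-_; con)

  Cauchy : (ℕ → ℚ) → Set
  Cauchy f = ∀ ε → 0ℚ < ε → ∃ λ N → ∀ m n → N ℕ.≤ m → N ℕ.≤ n → ∣ f m - f n ∣ < ε

  Null : (ℕ → ℚ) → Set
  Null f = ∀ ε → 0ℚ < ε → ∃ λ N → ∀ n → N ℕ.≤ n → ∣ f n ∣ < ε

  AwayFromZero : (ℕ → ℚ) → Set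
  AwayFromZero f = ∃ λ ε → 0ℚ < ε × ∃ λ N → ∀ n → N ℕ.≤ n → ε < ∣ f n ∣

  Bounded : (ℕ → ℚ) → Set
  Bounded f = ∃ λ B → 0ℚ < B × ∃ λ N → ∀ n → N ℕ.≤ n → ∣ f n ∣ ≤ B

  private
    variable
      f g : ℕ → ℚ

    abstract
      half : ∀ ε → 0ℚ < ε → ∃ λ δ → 0ℚ < δ × δ + δ ≡ ε
      half ε 0<ε = ½ * ε
        , subst (_< ½ * ε) (ℚ.*-zeroʳ ½) (ℚ.*-monoʳ-<-pos ½ 0<ε)
        , trans (sym (ℚ.*-distribʳ-+ ε ½ ½)) (ℚ.*-identityˡ ε)

      *-swap : ∀ a b c → a * (b * c) ≡ b * (a * c)
      *-swap a b c = solve 3 (λ a b c → a :* (b :* c) := b :* (a :* c)) refl a b c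

      quot : ∀ ε B → 0ℚ < ε → 0ℚ < B → ∃ λ δ → 0ℚ < δ × B * δ ≡ ε
      quot ε B 0<ε 0<B = ε * r
        , subst (_< ε * r) (ℚ.*-zeroʳ ε)
            (ℚ.*-monoʳ-<-pos ε {{ℚ.positive 0<ε}} (ℚ.positive⁻¹ r {{ℚ.1/pos⇒pos B {{ℚ.positive 0<B}}}}))
        , trans (*-swap B ε r)
            (trans (cong (ε *_) (ℚ.*-inverseʳ B {{nz}})) (ℚ.*-identityʳ ε))
        where
        nz : ℚ.NonZero B
        nz = ℚ.pos⇒nonZero B {{ℚ.positive 0<B}}
        r : ℚ
        r = (ℚ.1/ B) {{nz}}

      0<1 : 0ℚ < 1ℚ
      0<1 = ℚ.positive⁻¹ 1ℚ

      tri : ∀ a b → ∣ a ∣ ≤ ∣ b ∣ + ∣ a - b ∣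
      tri a b = subst (λ c → ∣ c ∣ ≤ ∣ b ∣ + ∣ a - b ∣)
        (solve 2 (λ a b → b :+ (a :- b) := a) refl a b) (ℚ.∣p+q∣≤∣p∣+∣q∣ b (a - b))

      ∣-∣-comm : ∀ a b → ∣ a - b ∣ ≡ ∣ b - a ∣
      ∣-∣-comm a b = trans (sym (ℚ.∣-p∣≡∣p∣ (a - b)))
        (cong ∣_∣ (solve 2 (λ a b → :- (a :- b) := b :- a) refl a b))

      mul-< : ∀ a b B δ → 0ℚ < B → ∣ a ∣ ≤ B → ∣ b ∣ < δ → ∣ a * b ∣ < B * δ
      mul-< a b B δ 0<B a≤B b<δ = subst (_< B * δ) (sym (ℚ.∣p*q∣≡∣p∣*∣q∣ a b))
        (ℚ.≤-<-trans
          (ℚ.*-monoʳ-≤-nonNeg ∣ b ∣ {{ℚ.∣-∣-nonNeg b}} a≤B)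
          (ℚ.*-monoʳ-<-pos B {{ℚ.positive 0<B}} b<δ))

      add-< : ∀ a b {δ ε} → δ + δ ≡ ε → ∣ a ∣ < δ → ∣ b ∣ < δ → ∣ a + b ∣ < ε
      add-< a b refl a<δ b<δ = ℚ.≤-<-trans (ℚ.∣p+q∣≤∣p∣+∣q∣ a b) (ℚ.+-mono-< a<δ b<δ)

      cancelʳ : ∀ {a b} q → a + q < b + q → a < b
      cancelʳ {a} {b} q lt = subst₂ _<_ (eq a) (eq b) (ℚ.+-monoˡ-< (- q) lt)
        where
        eq : ∀ c → (c + q) + - q ≡ c
        eq c = solve 2 (λ c q → (c :+ q) :+ :- q := c) refl c q

      persist : ∀ a b q → q + q < ∣ a ∣ → ∣ a - b ∣ < q → q < ∣ b ∣
      persist a b q qq<a a-b<q = cancelʳ q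
        (ℚ.<-≤-trans qq<a (ℚ.≤-trans (tri a b) (ℚ.+-monoʳ-≤ ∣ b ∣ (ℚ.<⇒≤ a-b<q))))

      p*p≡∣p∣*∣p∣ : ∀ p → p * p ≡ ∣ p ∣ * ∣ p ∣
      p*p≡∣p∣*∣p∣ p with ℚ.∣p∣≡p∨∣p∣≡-p p
      ... | inj₁ eq = sym (cong₂ _*_ eq eq)
      ... | inj₂ eq = trans (solve 1 (λ p → p :* p := :- p :* :- p) refl p) (sym (cong₂ _*_ eq eq))

      0≤p*p : ∀ p → 0ℚ ≤ p * p
      0≤p*p p = subst (0ℚ ≤_) (trans (ℚ.∣p*q∣≡∣p∣*∣q∣ p p) (sym (p*p≡∣p∣*∣p∣ p))) (ℚ.0≤∣p∣ (p * p))

  null-≗ : (∀ n → f n ≡ g n) → Null f → Null g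
  null-≗ f≗g nf ε 0<ε with nf ε 0<ε
  ... | N , h = N , λ n N≤n → subst (λ c → ∣ c ∣ < ε) (f≗g n) (h n N≤n)

  null-0 : (∀ n → f n ≡ 0ℚ) → Null f
  null-0 f≗0 = null-≗ (λ n → sym (f≗0 n)) (λ ε 0<ε → 0 , λ _ _ → 0<ε)

  null-+ : Null f → Null g → Null (λ n → f n + g n)
  null-+ {f} {g} nf ng ε 0<ε with half ε 0<ε
  ... | δ , 0<δ , eq with nf δ 0<δ | ng δ 0<δ
  ... | N , h | M , k = N ℕ.⊔ M , λ n le →
    add-< (f n) (g n) eq (h n (ℕ.m⊔n≤o⇒m≤o N M le)) (k n (ℕ.m⊔n≤o⇒n≤o N M le))

  null-neg : Null f → Null (λ n → - f n)
  null-neg {f} nf ε 0<ε with nf ε 0<ε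
  ... | N , h = N , λ n le → subst (_< ε) (sym (ℚ.∣-p∣≡∣p∣ (f n))) (h n le)

  null-* : Bounded f → Null g → Null (λ n → f n * g n)
  null-* {f} {g} (B , 0<B , N , h) ng ε 0<ε with quot ε B 0<ε 0<B
  ... | δ , 0<δ , eq with ng δ 0<δ
  ... | M , k = N ℕ.⊔ M , λ n le → subst (∣ f n * g n ∣ <_) eq
    (mul-< (f n) (g n) B δ 0<B (h n (ℕ.m⊔n≤o⇒m≤o N M le)) (k n (ℕ.m⊔n≤o⇒n≤o N M le)))

  bounded : Cauchy f → Bounded f
  bounded {f} cf with cf 1ℚ 0<1
  ... | N , h = ∣ f N ∣ + 1ℚ
    , ℚ.+-mono-≤-< (ℚ.0≤∣p∣ (f N)) 0<1
    , N , λ n le → ℚ.≤-trans (tri (f n) (f N))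
                     (ℚ.+-monoʳ-≤ ∣ f N ∣ (ℚ.<⇒≤ (h n N le ℕ.≤-refl)))

  cauchy-const : ∀ q → Cauchy (λ _ → q)
  cauchy-const q ε 0<ε = 0 , λ _ _ _ _ →
    subst (λ c → ∣ c ∣ < ε) (sym (ℚ.+-inverseʳ q)) 0<ε

  cauchy-+ : Cauchy f → Cauchy g → Cauchy (λ n → f n + g n)
  cauchy-+ {f} {g} cf cg ε 0<ε with half ε 0<ε
  ... | δ , 0<δ , eq with cf δ 0<δ | cg δ 0<δ
  ... | N , h | M , k = N ℕ.⊔ M , λ m n le le′ →
    subst (λ c → ∣ c ∣ < ε)
      (solve 4 (λ a b c d → (a :- b) :+ (c :- d) := (a :+ c) :- (b :+ d)) refl (f m) (f n) (g m) (g n))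
      (add-< (f m - f n) (g m - g n) eq
        (h m n (ℕ.m⊔n≤o⇒m≤o N M le) (ℕ.m⊔n≤o⇒m≤o N M le′))
        (k m n (ℕ.m⊔n≤o⇒n≤o N M le) (ℕ.m⊔n≤o⇒n≤o N M le′)))

  cauchy-neg : Cauchy f → Cauchy (λ n → - f n)
  cauchy-neg {f} cf ε 0<ε with cf ε 0<ε
  ... | N , h = N , λ m n le le′ → subst (_< ε)
    (trans (∣-∣-comm (f m) (f n))
      (cong ∣_∣ (solve 2 (λ a b → b :- a := (:- a) :- (:- b)) refl (f m) (f n))))
    (h m n le le′)

  cauchy-* : Cauchy f → Cauchy g → Cauchy (λ n → f n * g n)
  cauchy-* {f} {g} cf cg ε 0<ε with half ε 0<ε | bounded cf | bounded cg
  ... | δ , 0<δ , eq | B , 0<B , N₁ , b | C , 0<C , N₂ , c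
    with quot δ B 0<δ 0<B | quot δ C 0<δ 0<C
  ... | β , 0<β , eqβ | γ , 0<γ , eqγ with cf γ 0<γ | cg β 0<β
  ... | N₃ , h | N₄ , k = (N₁ ℕ.⊔ N₂) ℕ.⊔ (N₃ ℕ.⊔ N₄) , λ m n le le′ →
    subst (λ c → ∣ c ∣ < ε)
      (solve 4 (λ a b c d → a :* (c :- d) :+ d :* (a :- b) := a :* c :- b :* d) refl (f m) (f n) (g m) (g n))
      (add-< (f m * (g m - g n)) (g n * (f m - f n)) eq
        (subst (∣ f m * (g m - g n) ∣ <_) eqβ
          (mul-< (f m) (g m - g n) B β 0<B (b m (p₁ le)) (k m n (p₄ le) (p₄ le′))))
        (subst (∣ g n * (f m - f n) ∣ <_) eqγ
          (mul-< (g n) (f m - f n) C γ 0<C (c n (p₂ le′)) (h m n (p₃ le) (p₃ le′)))))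
    where
    p₁ : ∀ {m} → (N₁ ℕ.⊔ N₂) ℕ.⊔ (N₃ ℕ.⊔ N₄) ℕ.≤ m → N₁ ℕ.≤ m
    p₁ le = ℕ.m⊔n≤o⇒m≤o N₁ N₂ (ℕ.m⊔n≤o⇒m≤o (N₁ ℕ.⊔ N₂) _ le)
    p₂ : ∀ {m} → (N₁ ℕ.⊔ N₂) ℕ.⊔ (N₃ ℕ.⊔ N₄) ℕ.≤ m → N₂ ℕ.≤ m
    p₂ le = ℕ.m⊔n≤o⇒n≤o N₁ N₂ (ℕ.m⊔n≤o⇒m≤o (N₁ ℕ.⊔ N₂) _ le)
    p₃ : ∀ {m} → (N₁ ℕ.⊔ N₂) ℕ.⊔ (N₃ ℕ.⊔ N₄) ℕ.≤ m → N₃ ℕ.≤ m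
    p₃ le = ℕ.m⊔n≤o⇒m≤o N₃ N₄ (ℕ.m⊔n≤o⇒n≤o (N₁ ℕ.⊔ N₂) _ le)
    p₄ : ∀ {m} → (N₁ ℕ.⊔ N₂) ℕ.⊔ (N₃ ℕ.⊔ N₄) ℕ.≤ m → N₄ ℕ.≤ m
    p₄ le = ℕ.m⊔n≤o⇒n≤o N₃ N₄ (ℕ.m⊔n≤o⇒n≤o (N₁ ℕ.⊔ N₂) _ le)

  away-≗ : (∀ n → ∣ f n ∣ ≡ ∣ g n ∣) → AwayFromZero f → AwayFromZero g
  away-≗ eq (ε , 0<ε , N , h) = ε , 0<ε , N , λ n le → subst (ε <_) (eq n) (h n le)

  away-1 : AwayFromZero (λ _ → 1ℚ)
  away-1 with half 1ℚ 0<1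
  ... | δ , 0<δ , eq = δ , 0<δ , 0 , λ _ _ →
    subst₂ _<_ (ℚ.+-identityʳ δ) eq (ℚ.+-monoʳ-< δ 0<δ)

  null⇒¬away : Null f → ¬ AwayFromZero f
  null⇒¬away nf (ε , 0<ε , N , h) with nf ε 0<ε
  ... | M , k = ℚ.<-irrefl refl
    (ℚ.<-trans (h (N ℕ.⊔ M) (ℕ.m≤m⊔n N M)) (k (N ℕ.⊔ M) (ℕ.m≤n⊔m N M)))

  away-null : Null (λ n → f n - g n) → AwayFromZero f → AwayFromZero g
  away-null {f} {g} nf-g (ε , 0<ε , N , h) with half ε 0<ε
  ... | δ , 0<δ , refl with nf-g δ 0<δ
  ... | M , k = δ , 0<δ , N ℕ.⊔ M , λ n le →
    persist (f n) (g n) δ (h n (ℕ.m⊔n≤o⇒m≤o N M le)) (k n (ℕ.m⊔n≤o⇒n≤o N M le))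

  private
    decide : Cauchy f → ∀ q → 0ℚ < q →
             ∃ λ N → ∀ M → N ℕ.≤ M → q + q < ∣ f M ∣ → AwayFromZero f
    decide {f} cf q 0<q with cf q 0<q
    ... | N , h = N , λ M N≤M lt → q , 0<q , N , λ n le →
      persist (f M) (f n) q lt (h M n N≤M le)

  ¬away⇒null : Cauchy f → ¬ AwayFromZero f → Null f
  ¬away⇒null {f} cf ¬a ε 0<ε with half ε 0<ε
  ... | δ , 0<δ , refl with half δ 0<δ
  ... | q , 0<q , refl with decide cf q 0<q | cf (q + q) 0<δ
  ... | N , d | M , h = N ℕ.⊔ M , λ n le → ℚ.≤-<-trans (tri (f n) (f (N ℕ.⊔ M)))
    (ℚ.+-mono-≤-<
      (ℚ.≮⇒≥ λ lt → ¬a (d (N ℕ.⊔ M) (ℕ.m≤m⊔n N M) lt))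
      (h n (N ℕ.⊔ M) (ℕ.m⊔n≤o⇒n≤o N M le) (ℕ.m≤n⊔m N M)))

  away-+ : Cauchy f → Cauchy g → AwayFromZero (λ n → f n + g n) → AwayFromZero f ⊎ AwayFromZero g
  away-+ {f} {g} cf cg (ε , 0<ε , N , h) with half ε 0<ε
  ... | δ , 0<δ , refl with half δ 0<δ
  ... | q , 0<q , refl with decide cf q 0<q | decide cg q 0<q
  ... | N₁ , d₁ | N₂ , d₂ = helper
    where
    M = N ℕ.⊔ (N₁ ℕ.⊔ N₂)
    N₁≤M = ℕ.≤-trans (ℕ.m≤m⊔n N₁ N₂) (ℕ.m≤n⊔m N (N₁ ℕ.⊔ N₂))
    N₂≤M = ℕ.≤-trans (ℕ.m≤n⊔m N₁ N₂) (ℕ.m≤n⊔m N (N₁ ℕ.⊔ N₂))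
    lt : (q + q) + (q + q) < ∣ f M ∣ + ∣ g M ∣
    lt = ℚ.<-≤-trans (h M (ℕ.m≤m⊔n N (N₁ ℕ.⊔ N₂))) (ℚ.∣p+q∣≤∣p∣+∣q∣ (f M) (g M))
    helper : AwayFromZero _ ⊎ AwayFromZero _
    helper with (q + q) ℚ.<? ∣ f M ∣
    ... | yes p = inj₁ (d₁ M N₁≤M p)
    ... | no ¬p = inj₂ (d₂ M N₂≤M (cancelʳ (q + q)
      (ℚ.<-≤-trans lt (subst (_≤ ∣ g M ∣ + (q + q)) (ℚ.+-comm ∣ g M ∣ ∣ f M ∣)
        (ℚ.+-monoʳ-≤ ∣ g M ∣ (ℚ.≮⇒≥ ¬p))))))

  away-*ʳ : Bounded f → AwayFromZero (λ n → f n * g n) → AwayFromZero g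
  away-*ʳ {f} {g} (B , 0<B , N , b) (ε , 0<ε , M , h) with quot ε B 0<ε 0<B
  ... | δ , 0<δ , refl = δ , 0<δ , N ℕ.⊔ M , λ n le →
    ℚ.*-cancelˡ-<-nonNeg B {{ℚ.nonNegative (ℚ.<⇒≤ 0<B)}}
      (ℚ.<-≤-trans (h n (ℕ.m⊔n≤o⇒n≤o N M le))
        (subst (_≤ B * ∣ g n ∣) (sym (ℚ.∣p*q∣≡∣p∣*∣q∣ (f n) (g n)))
          (ℚ.*-monoʳ-≤-nonNeg ∣ g n ∣ {{ℚ.∣-∣-nonNeg (g n)}} (b n (ℕ.m⊔n≤o⇒m≤o N M le)))))

  away-sq : AwayFromZero f → AwayFromZero (λ n → f n * f n + g n * g n)
  away-sq {f} {g} (ε , 0<ε , N , h) = ε * ε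
    , subst (_< ε * ε) (ℚ.*-zeroʳ ε) (ℚ.*-monoʳ-<-pos ε {{ℚ.positive 0<ε}} 0<ε)
    , N , λ n le → subst (ε * ε <_)
        (sym (ℚ.0≤p⇒∣p∣≡p (ℚ.+-mono-≤ (0≤p*p (f n)) (0≤p*p (g n)))))
        (subst (_< f n * f n + g n * g n) (ℚ.+-identityʳ (ε * ε))
          (ℚ.+-mono-<-≤ (subst (ε * ε <_) (sym (p*p≡∣p∣*∣p∣ (f n))) (sq (h n le))) (0≤p*p (g n))))
    where
    sq : ∀ {a} → ε < a → ε * ε < a * a
    sq {a} ε<a = ℚ.<-trans (ℚ.*-monoʳ-<-pos ε {{ℚ.positive 0<ε}} ε<a)
      (ℚ.*-monoˡ-<-pos a {{ℚ.positive (ℚ.<-trans 0<ε ε<a)}} ε<a)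

  recip : ℚ → ℚ
  recip q with q ℚ.≟ 0ℚ
  ... | yes _  = 0ℚ
  ... | no q≢0 = (ℚ.1/ q) {{ℚ.≢-nonZero q≢0}}

  private
    *-recip : ∀ q → q ≢ 0ℚ → q * recip q ≡ 1ℚ
    *-recip q q≢0 with q ℚ.≟ 0ℚ
    ... | yes q≡0 = contradiction q≡0 q≢0
    ... | no q≢0′ = ℚ.*-inverseʳ q {{ℚ.≢-nonZero q≢0′}}

    <∣∣⇒≢0 : ∀ {ε} q → 0ℚ < ε → ε < ∣ q ∣ → q ≢ 0ℚ
    <∣∣⇒≢0 q 0<ε ε<q refl = ℚ.<-irrefl refl (ℚ.<-trans 0<ε ε<q)

    recip-≤ : ∀ q ε η → 0ℚ < ε → 0ℚ < η → ε * η ≡ 1ℚ → ε < ∣ q ∣ → ∣ recip q ∣ ≤ η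
    recip-≤ q ε η 0<ε 0<η εη≡1 ε<q = ℚ.*-cancelˡ-≤-pos ε {{ℚ.positive 0<ε}}
      (ℚ.≤-trans
        (ℚ.*-monoʳ-≤-nonNeg ∣ recip q ∣ {{ℚ.∣-∣-nonNeg (recip q)}} (ℚ.<⇒≤ ε<q))
        (ℚ.≤-reflexive (trans (sym (ℚ.∣p*q∣≡∣p∣*∣q∣ q (recip q)))
          (trans (cong ∣_∣ (*-recip q (<∣∣⇒≢0 q 0<ε ε<q))) (sym εη≡1)))))

    recip-diff : ∀ a b ra rb → a * ra ≡ 1ℚ → b * rb ≡ 1ℚ → ra * (rb * (b - a)) ≡ ra - rb
    recip-diff a b ra rb ea eb = trans
      (solve 4 (λ a b ra rb → ra :* (rb :* (b :- a)) := ra :* (b :* rb) :- rb :* (a :* ra)) refl a b ra rb)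
      (cong₂ _-_ (trans (cong (ra *_) eb) (ℚ.*-identityʳ ra)) (trans (cong (rb *_) ea) (ℚ.*-identityʳ rb)))

  cauchy-recip : Cauchy f → AwayFromZero f → Cauchy (λ n → recip (f n))
  cauchy-recip {f} cf (ρ , 0<ρ , N , h) ε 0<ε with quot 1ℚ ρ 0<1 0<ρ
  ... | η , 0<η , eη with quot ε η 0<ε 0<η
  ... | δ , 0<δ , refl with quot δ η 0<δ 0<η
  ... | γ , 0<γ , refl with cf γ 0<γ
  ... | M , k = N ℕ.⊔ M , λ m n le le′ →
    let N≤m = ℕ.m⊔n≤o⇒m≤o N M le ; N≤n = ℕ.m⊔n≤o⇒m≤o N M le′ in
    subst (λ c → ∣ c ∣ < η * (η * γ))
      (recip-diff (f m) (f n) _ _ (*-recip (f m) (<∣∣⇒≢0 (f m) 0<ρ (h m N≤m)))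
                                  (*-recip (f n) (<∣∣⇒≢0 (f n) 0<ρ (h n N≤n))))
      (mul-< (recip (f m)) _ η (η * γ) 0<η (recip-≤ (f m) ρ η 0<ρ 0<η eη (h m N≤m))
        (mul-< (recip (f n)) _ η γ 0<η (recip-≤ (f n) ρ η 0<ρ 0<η eη (h n N≤n))
          (k n m (ℕ.m⊔n≤o⇒n≤o N M le′) (ℕ.m⊔n≤o⇒n≤o N M le))))

  null-recip : AwayFromZero f → Null (λ n → f n * recip (f n) - 1ℚ)
  null-recip {f} (ρ , 0<ρ , N , h) ε 0<ε = N , λ n le →
    subst (λ c → ∣ c - 1ℚ ∣ < ε) (sym (*-recip (f n) (<∣∣⇒≢0 (f n) 0<ρ (h n le)))) 0<ε

-- Real numbers are Cauchy sequences of rationals, two of them being equal when their difference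
-- tends to zero, and apart when it is eventually bounded away from zero.

module Real where

  open Sequences

  infix  4 _≈_ _#_
  infixl 6 _+_
  infixl 7 _*_
  infix  8 -_

  record ℝ : Set where
    constructor mkℝ
    field
      seq    : ℕ → ℚ
      cauchy : Cauchy seq

  open ℝ public

  _≈_ : ℝ → ℝ → Set
  a ≈ b = Null (λ n → seq a n ℚ.- seq b n)

  _#_ : ℝ → ℝ → Set
  a # b = AwayFromZero (λ n → seq a n ℚ.- seq b n)

  fromℚ : ℚ → ℝ
  fromℚ q = mkℝ (λ _ → q) (cauchy-const q)

  _+_ : ℝ → ℝ → ℝ
  a + b = mkℝ (λ n → seq a n ℚ.+ seq b n) (cauchy-+ {seq a} {seq b} (cauchy a) (cauchy b))

  _*_ : ℝ → ℝ → ℝ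
  a * b = mkℝ (λ n → seq a n ℚ.* seq b n) (cauchy-* {seq a} {seq b} (cauchy a) (cauchy b))

  -_ : ℝ → ℝ
  - a = mkℝ (λ n → ℚ.- seq a n) (cauchy-neg {seq a} (cauchy a))

  open +-*-Solver using (solve; _:=_; _:+_; _:*_; _:-_; :-_)

  pointwise : ∀ {a b} → (∀ n → seq a n ≡ seq b n) → a ≈ b
  pointwise {a} {b} eq = null-0 λ n → trans (cong (ℚ._- seq b n) (eq n)) (ℚ.+-inverseʳ (seq b n))

  ≈-sym : ∀ {a b} → a ≈ b → b ≈ a
  ≈-sym {a} {b} p = null-≗ (λ n → solve 2 (λ a b → :- (a :- b) := b :- a) refl (seq a n) (seq b n)) (null-neg p)

  ≈-trans : ∀ {a b c} → a ≈ b → b ≈ c → a ≈ c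
  ≈-trans {a} {b} {c} p q = null-≗
    (λ n → solve 3 (λ a b c → (a :- b) :+ (b :- c) := a :- c) refl (seq a n) (seq b n) (seq c n))
    (null-+ p q)

  +-cong : ∀ {a b c d} → a ≈ b → c ≈ d → a + c ≈ b + d
  +-cong {a} {b} {c} {d} p q = null-≗
    (λ n → solve 4 (λ a b c d → (a :- b) :+ (c :- d) := (a :+ c) :- (b :+ d)) refl
             (seq a n) (seq b n) (seq c n) (seq d n))
    (null-+ p q)

  *-cong : ∀ {a b c d} → a ≈ b → c ≈ d → a * c ≈ b * d
  *-cong {a} {b} {c} {d} p q = null-≗
    (λ n → solve 4 (λ a b c d → a :* (c :- d) :+ d :* (a :- b) := a :* c :- b :* d) refl
             (seq a n) (seq b n) (seq c n) (seq d n))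
    (null-+ {λ n → seq a n ℚ.* (seq c n ℚ.- seq d n)} {λ n → seq d n ℚ.* (seq a n ℚ.- seq b n)}
      (null-* {seq a} (bounded {seq a} (cauchy a)) q) (null-* {seq d} (bounded {seq d} (cauchy d)) p))

  neg-cong : ∀ {a b} → a ≈ b → - a ≈ - b
  neg-cong {a} {b} p = null-≗
    (λ n → solve 2 (λ a b → :- (a :- b) := (:- a) :- (:- b)) refl (seq a n) (seq b n)) (null-neg p)

  #-sym : ∀ {a b} → a # b → b # a
  #-sym {a} {b} = away-≗ λ n → trans (sym (ℚ.∣-p∣≡∣p∣ (seq a n ℚ.- seq b n)))
    (cong ℚ.∣_∣ (solve 2 (λ a b → :- (a :- b) := b :- a) refl (seq a n) (seq b n)))

  cauchy-diff : ∀ a b → Cauchy (λ n → seq a n ℚ.- seq b n)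
  cauchy-diff a b = cauchy (a + - b)

  #-cotrans : Cotransitive _#_
  #-cotrans {a} {b} a#b c = away-+ (cauchy-diff a c) (cauchy-diff c b)
    (away-≗ (λ n → cong ℚ.∣_∣
      (solve 3 (λ a b c → a :- b := (a :- c) :+ (c :- b)) refl (seq a n) (seq b n) (seq c n))) a#b)

module Complex where

  open Sequences
  open Real using (ℝ; mkℝ; seq; cauchy; fromℚ; cauchy-diff)
  module R = Real

  infix  4 _≈_ _#_
  infixl 6 _+_
  infixl 7 _*_
  infix  8 -_

  record ℂ : Set where
    constructor _+i_
    field
      re im : ℝ

  open ℂ public

  open +-*-Solver using (solve; _:=_; _:+_; _:*_; _:-_; :-_; con)

  opaque

    _≈_ : ℂ → ℂ → Set
    z ≈ w = (re z R.≈ re w) × (im z R.≈ im w)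

    _#_ : ℂ → ℂ → Set
    z # w = (re z R.# re w) ⊎ (im z R.# im w)

    0ℂ 1ℂ : ℂ
    0ℂ = fromℚ 0ℚ +i fromℚ 0ℚ
    1ℂ = fromℚ 1ℚ +i fromℚ 0ℚ

    _+_ : ℂ → ℂ → ℂ
    z + w = (re z R.+ re w) +i (im z R.+ im w)

    _*_ : ℂ → ℂ → ℂ
    z * w = (re z R.* re w R.+ R.- (im z R.* im w)) +i (re z R.* im w R.+ im z R.* re w)

    -_ : ℂ → ℂ
    - z = (R.- re z) +i (R.- im z)

    private
      pointwise : ∀ {z w} → (∀ n → seq (re z) n ≡ seq (re w) n) → (∀ n → seq (im z) n ≡ seq (im w) n) → z ≈ w
      pointwise {z} {w} p q = R.pointwise {re z} {re w} p , R.pointwise {im z} {im w} q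

      ≈-refl : ∀ {z} → z ≈ z
      ≈-refl {z} = pointwise {z} {z} (λ _ → refl) (λ _ → refl)

      ≈-sym : ∀ {z w} → z ≈ w → w ≈ z
      ≈-sym {z} {w} (p , q) = R.≈-sym {re z} {re w} p , R.≈-sym {im z} {im w} q

      ≈-trans : ∀ {z w v} → z ≈ w → w ≈ v → z ≈ v
      ≈-trans {z} {w} {v} (p , q) (p′ , q′) =
        R.≈-trans {re z} {re w} {re v} p p′ , R.≈-trans {im z} {im w} {im v} q q′

      +-cong : ∀ {z z′ w w′} → z ≈ z′ → w ≈ w′ → z + w ≈ z′ + w′
      +-cong {z} {z′} {w} {w′} (p , q) (p′ , q′) =
        R.+-cong {re z} {re z′} {re w} {re w′} p p′ , R.+-cong {im z} {im z′} {im w} {im w′} q q′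

      *-cong : ∀ {z z′ w w′} → z ≈ z′ → w ≈ w′ → z * w ≈ z′ * w′
      *-cong {z} {z′} {w} {w′} (p , q) (p′ , q′) =
        R.+-cong {re z R.* re w} {re z′ R.* re w′} {R.- (im z R.* im w)} {R.- (im z′ R.* im w′)}
          (R.*-cong {re z} {re z′} {re w} {re w′} p p′)
          (R.neg-cong {im z R.* im w} {im z′ R.* im w′} (R.*-cong {im z} {im z′} {im w} {im w′} q q′)) ,
        R.+-cong {re z R.* im w} {re z′ R.* im w′} {im z R.* re w} {im z′ R.* re w′}
          (R.*-cong {re z} {re z′} {im w} {im w′} p q′)
          (R.*-cong {im z} {im z′} {re w} {re w′} q p′)

      neg-cong : ∀ {z w} → z ≈ w → - z ≈ - w
      neg-cong {z} {w} (p , q) = R.neg-cong {re z} {re w} p , R.neg-cong {im z} {im w} q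

      +-assoc : ∀ z w v → (z + w) + v ≈ z + (w + v)
      +-assoc z w v = pointwise {(z + w) + v} {z + (w + v)}
        (λ n → ℚ.+-assoc (seq (re z) n) (seq (re w) n) (seq (re v) n))
        (λ n → ℚ.+-assoc (seq (im z) n) (seq (im w) n) (seq (im v) n))

      +-comm : ∀ z w → z + w ≈ w + z
      +-comm z w = pointwise {z + w} {w + z}
        (λ n → ℚ.+-comm (seq (re z) n) (seq (re w) n))
        (λ n → ℚ.+-comm (seq (im z) n) (seq (im w) n))

      +-identityˡ : ∀ z → 0ℂ + z ≈ z
      +-identityˡ z = pointwise {0ℂ + z} {z}
        (λ n → ℚ.+-identityˡ (seq (re z) n)) (λ n → ℚ.+-identityˡ (seq (im z) n))

      +-inverseˡ : ∀ z → - z + z ≈ 0ℂ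
      +-inverseˡ z = pointwise { - z + z} {0ℂ}
        (λ n → ℚ.+-inverseˡ (seq (re z) n)) (λ n → ℚ.+-inverseˡ (seq (im z) n))

      *-comm : ∀ z w → z * w ≈ w * z
      *-comm z w = pointwise {z * w} {w * z}
        (λ n → solve 4 (λ a b c d → a :* c :+ :- (b :* d) := c :* a :+ :- (d :* b)) refl
                 (seq (re z) n) (seq (im z) n) (seq (re w) n) (seq (im w) n))
        (λ n → solve 4 (λ a b c d → a :* d :+ b :* c := c :* b :+ d :* a) refl
                 (seq (re z) n) (seq (im z) n) (seq (re w) n) (seq (im w) n))

      *-assoc : ∀ z w v → (z * w) * v ≈ z * (w * v)
      *-assoc z w v = pointwise {(z * w) * v} {z * (w * v)}
        (λ n → solve 6 (λ a b c d e f →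
                   (a :* c :+ :- (b :* d)) :* e :+ :- ((a :* d :+ b :* c) :* f) :=
                   a :* (c :* e :+ :- (d :* f)) :+ :- (b :* (c :* f :+ d :* e))) refl
                 (seq (re z) n) (seq (im z) n) (seq (re w) n) (seq (im w) n) (seq (re v) n) (seq (im v) n))
        (λ n → solve 6 (λ a b c d e f →
                   (a :* c :+ :- (b :* d)) :* f :+ (a :* d :+ b :* c) :* e :=
                   a :* (c :* f :+ d :* e) :+ b :* (c :* e :+ :- (d :* f))) refl
                 (seq (re z) n) (seq (im z) n) (seq (re w) n) (seq (im w) n) (seq (re v) n) (seq (im v) n))

      *-identityˡ : ∀ z → 1ℂ * z ≈ z
      *-identityˡ z = pointwise {1ℂ * z} {z}
        (λ n → solve 2 (λ a b → con 1ℚ :* a :+ :- (con 0ℚ :* b) := a) refl (seq (re z) n) (seq (im z) n))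
        (λ n → solve 2 (λ a b → con 1ℚ :* b :+ con 0ℚ :* a := b) refl (seq (re z) n) (seq (im z) n))

      distribˡ : ∀ z w v → z * (w + v) ≈ (z * w) + (z * v)
      distribˡ z w v = pointwise {z * (w + v)} {(z * w) + (z * v)}
        (λ n → solve 6 (λ a b c d e f →
                   a :* (c :+ e) :+ :- (b :* (d :+ f)) :=
                   (a :* c :+ :- (b :* d)) :+ (a :* e :+ :- (b :* f))) refl
                 (seq (re z) n) (seq (im z) n) (seq (re w) n) (seq (im w) n) (seq (re v) n) (seq (im v) n))
        (λ n → solve 6 (λ a b c d e f →
                   a :* (d :+ f) :+ b :* (c :+ e) :=
                   (a :* d :+ b :* c) :+ (a :* f :+ b :* e)) refl
                 (seq (re z) n) (seq (im z) n) (seq (re w) n) (seq (im w) n) (seq (re v) n) (seq (im v) n))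

      distribʳ : ∀ z w v → (w + v) * z ≈ (w * z) + (v * z)
      distribʳ z w v = ≈-trans {(w + v) * z} {z * (w + v)} {(w * z) + (v * z)} (*-comm (w + v) z)
        (≈-trans {z * (w + v)} {(z * w) + (z * v)} {(w * z) + (v * z)} (distribˡ z w v)
          (+-cong {z * w} {w * z} {z * v} {v * z} (*-comm z w) (*-comm z v)))

      #-irrefl : ∀ {z w} → z ≈ w → ¬ z # w
      #-irrefl (p , q) = [ null⇒¬away p , null⇒¬away q ]′

      #-sym : ∀ {z w} → z # w → w # z
      #-sym {z} {w} (inj₁ p) = inj₁ (R.#-sym {re z} {re w} p)
      #-sym {z} {w} (inj₂ q) = inj₂ (R.#-sym {im z} {im w} q)

      #-cotrans : Cotransitive _#_
      #-cotrans {z} {w} (inj₁ p) v = [ (λ q → inj₁ (inj₁ q)) , (λ q → inj₂ (inj₁ q)) ]′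
        (R.#-cotrans {re z} {re w} p (re v))
      #-cotrans {z} {w} (inj₂ p) v = [ (λ q → inj₁ (inj₂ q)) , (λ q → inj₂ (inj₂ q)) ]′
        (R.#-cotrans {im z} {im w} p (im v))

      -- (a + b i)⁻¹ = a / (a² + b²) - (b / (a² + b²)) i
      #⇒invertible : ∀ {z w} → z # w → Invertible _≈_ 1ℂ _*_ (z + - w)
      #⇒invertible {z} {w} z#w = u⁻¹
        , ≈-trans {u⁻¹ * u} {u * u⁻¹} {1ℂ} (*-comm u⁻¹ u) u*u⁻¹≈1
        , u*u⁻¹≈1
        where
        u : ℂ
        u = z + - w
        a b s : ℝ
        a = re u
        b = im u
        s = a R.* a R.+ b R.* b
        away : AwayFromZero (seq s)
        away = [ away-sq {seq a} {seq b}
               , (λ q → away-≗ {_} {seq s} (λ n → cong ℚ.∣_∣ (ℚ.+-comm (seq b n ℚ.* seq b n) (seq a n ℚ.* seq a n)))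
                          (away-sq {seq b} {seq a} q)) ]′ z#w
        r : ℝ
        r = mkℝ (λ n → recip (seq s n)) (cauchy-recip (cauchy s) away)
        u⁻¹ : ℂ
        u⁻¹ = (a R.* r) +i (R.- (b R.* r))
        u*u⁻¹≈1 : u * u⁻¹ ≈ 1ℂ
        u*u⁻¹≈1 =
          null-≗ (λ n → solve 3 (λ a b r →
                     (a :* a :+ b :* b) :* r :- con 1ℚ :=
                     (a :* (a :* r) :+ :- (b :* :- (b :* r))) :- con 1ℚ) refl (seq a n) (seq b n) (seq r n))
            (null-recip {seq s} away) ,
          R.pointwise {im (u * u⁻¹)} {fromℚ 0ℚ} (λ n →
            solve 3 (λ a b r → a :* :- (b :* r) :+ b :* (a :* r) := con 0ℚ) refl (seq a n) (seq b n) (seq r n))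

      invertible⇒# : ∀ {z w} → Invertible _≈_ 1ℂ _*_ (z + - w) → z # w
      invertible⇒# {z} {w} (v , (v*u≈1 , _) , _) =
        [ (λ p → inj₁ (away-*ʳ {seq (re v)} {seq (re u)} (bounded {seq (re v)} (cauchy (re v))) p))
        , (λ p → inj₂ (away-*ʳ {seq (im v)} {seq (im u)} (bounded {seq (im v)} (cauchy (im v)))
            (away-≗ {λ n → ℚ.- (seq (im v) n ℚ.* seq (im u) n)} (λ n → ℚ.∣-p∣≡∣p∣ (seq (im v) n ℚ.* seq (im u) n)) p))) ]′
        (away-+ {seq (re v R.* re u)} {seq (R.- (im v R.* im u))}
          (cauchy (re v R.* re u)) (cauchy (R.- (im v R.* im u)))
          (away-null {λ _ → 1ℚ} {seq (re (v * u))} (R.≈-sym {re (v * u)} {re 1ℂ} v*u≈1) away-1))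
        where
        u : ℂ
        u = z + - w

      tight : Tight _≈_ _#_
      tight z w =
        (λ ¬z#w → ¬away⇒null (cauchy-diff (re z) (re w)) (λ p → ¬z#w (inj₁ p))
                , ¬away⇒null (cauchy-diff (im z) (im w)) (λ q → ¬z#w (inj₂ q)))
        , #-irrefl {z} {w}

  isCommutativeRing : IsCommutativeRing _≈_ _+_ _*_ -_ 0ℂ 1ℂ
  isCommutativeRing = record
    { isRing = record
      { +-isAbelianGroup = record
        { isGroup = record
          { isMonoid = record
            { isSemigroup = record
              { isMagma = record
                { isEquivalence = record { refl = ≈-refl ; sym = ≈-sym ; trans = ≈-trans }
                ; ∙-cong = +-cong
                }
              ; assoc = +-assoc
              }
            ; identity = +-identityˡ , λ z → ≈-trans (+-comm z 0ℂ) (+-identityˡ z)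
            }
          ; inverse = +-inverseˡ , λ z → ≈-trans (+-comm z (- z)) (+-inverseˡ z)
          ; ⁻¹-cong = neg-cong
          }
        ; comm = +-comm
        }
      ; *-cong = *-cong
      ; *-assoc = *-assoc
      ; *-identity = *-identityˡ , λ z → ≈-trans (*-comm z 1ℂ) (*-identityˡ z)
      ; distrib = distribˡ , distribʳ
      }
    ; *-comm = *-comm
    }

  isHeytingField : IsHeytingField _≈_ _#_ _+_ _*_ -_ 0ℂ 1ℂ
  isHeytingField = record
    { isHeytingCommutativeRing = record
      { isCommutativeRing = isCommutativeRing
      ; isApartnessRelation = record { irrefl = #-irrefl ; sym = #-sym ; cotrans = #-cotrans }
      ; #⇒invertible = #⇒invertible
      ; invertible⇒# = invertible⇒#
      }
    ; tight = tight
    }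

  ℂ-heytingField : HeytingField 0ℓ 0ℓ 0ℓ
  ℂ-heytingField = record { isHeytingField = isHeytingField }

module Expressions {c ℓ₁ ℓ₂} (K : HeytingField c ℓ₁ ℓ₂) where

  open HeytingField K
  open HeytingCommutativeRing heytingCommutativeRing using (commutativeRing)
  open CommutativeRing commutativeRing using (semiring)
  open import Algebra.Definitions.RawSemiring (Semiring.rawSemiring semiring) public
    using (_^_; sum) renaming (_×_ to _·_)

  2# 4# : Carrier
  2# = 1# + 1#
  4# = 2# + 2#

  -- #⇒invertible inverts y - 0#, which equals y.
  inverse : ∀ y → y # 0# → Carrier
  inverse y y#0 = proj₁ (#⇒invertible y#0)

  infixl 7 _/_[_]
  infix  8 _^ᶻ_[_]

  _/_[_] : ∀ (x y : Carrier) → y # 0# → Carrier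
  x / y [ y#0 ] = x * inverse y y#0

  _^ᶻ_[_] : ∀ (y : Carrier) → ℤ → y # 0# → Carrier
  y ^ᶻ + m      [ y#0 ] = y ^ m
  y ^ᶻ -[1+ m ] [ y#0 ] = inverse y y#0 ^ suc m

  -- Half-open range: ∑[ a ≤ k < b ] f k = f a + ... + f (b - 1), which is empty when b ≤ a.
  infix 5 ∑-range
  ∑-range : ℕ → ℕ → (ℕ → Carrier) → Carrier
  ∑-range a b f = sum {b ℕ.∸ a} λ i → f (a ℕ.+ toℕ i)

  syntax ∑-range a b (λ k → t) = ∑[ a ≤ k < b ] t

  -- T and U are the Chebyshev polynomials of the first and second kind, F the Fibonacci
  -- polynomials, each evaluated at x by its recurrence.
  T : ℕ → Carrier → Carrier
  T 0             x = 1#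
  T 1             x = x
  T (suc (suc n)) x = 2# * x * T (suc n) x - T n x

  U : ℕ → Carrier → Carrier
  U 0             x = 1#
  U 1             x = 2# * x
  U (suc (suc n)) x = 2# * x * U (suc n) x - U n x

  F : ℕ → Carrier → Carrier
  F 0             x = 0#
  F 1             x = 1#
  F (suc (suc n)) x = x * F (suc n) x + F n x

open Complex public using (ℂ; ℂ-heytingField)
open HeytingField ℂ-heytingField public using (_≈_; _#_; _+_; _*_; _-_; -_; 0#; 1#)
open Expressions ℂ-heytingField public

opaque

  unfolding Complex._#_

  2#0 : 2# # 0#
  2#0 = inj₁ (1ℚ , ℚ.positive⁻¹ 1ℚ , 0 , λ _ _ → 1<2)
    where
    1<2 : 1ℚ ℚ.< 1ℚ ℚ.+ 1ℚ
    1<2 = ℚ.+-monoʳ-< 1ℚ (ℚ.positive⁻¹ 1ℚ)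

{-# OPTIONS --safe #-}
module Submission where

-- Each identity compares two expansions of one combination of n-th powers. By Binet's formulas
-- 2 T, 2√(x²-1) U and √(x²+4) F are sequences u Aᵏ - v Bᵏ, so after multiplication by a suitable
-- weight both sides become Σ C(n,k) pᵏ qⁿ⁻ᵏ (κ - (-1)ⁿ⁻ᵏ μ) (u Aᵏ - v Bᵏ), which the binomial
-- theorem turns into the powers of pA ± q and pB ± q. For the bases in the theorem pA, pB = m ± q′
-- and p′A′, p′B′ = m ± q with the same m, where (p′, q′, A′, B′) belong to the other side; hence
-- both sides involve exactly the four powers (m ± q ± q′)ⁿ, with the same coefficients.
-- The weights are invertible, being made of bases that are apart from zero.

open import Algebra.Bundles using (CommutativeRing)
open import Algebra.Apartness.Bundles using (HeytingCommutativeRing; HeytingField)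
open import Data.Fin.Base using (fromℕ; inject₁; toℕ)
open import Data.Fin.Properties using (toℕ-fromℕ; toℕ-inject₁; toℕ<n)
open import Data.Integer.Base as ℤ using (ℤ; +_; -[1+_]; _⊖_)
import Data.Integer.Properties as ℤ
open import Data.Maybe.Base using (Maybe; just; nothing)
open import Data.Nat.Base as ℕ using (ℕ; zero; suc; _∸_; z≤n; s≤s)
import Data.Nat.Properties as ℕ
open import Data.Nat.Combinatorics using (_C_)
open import Data.Product.Base using (∃; _×_; _,_; proj₁; proj₂)
import Data.Sign.Base as Sign
open import Relation.Binary.PropositionalEquality.Core as ≡ using (_≡_)
open import Relation.Nullary.Decidable using (yes; no)

open import Defs using (module Expressions)

-- A ring solver with integer coefficients.

module IntegerCoefficients {c ℓ} (R : CommutativeRing c ℓ) where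

  open CommutativeRing R
  open import Algebra.Properties.Ring ring
  open import Algebra.Properties.Semiring.Mult.TCOptimised semiring
    using (1+×; ×-homo-+; ×1-homo-*) renaming (_×_ to _·_)
  open import Algebra.Solver.Ring.AlmostCommutativeRing
    using (_-Raw-AlmostCommutative⟶_; fromCommutativeRing)
  open import Relation.Binary.Reasoning.Setoid setoid

  private
    -- With the type-checking-optimised multiple, `1 · 1#` reduces to `1#` itself, so `con (+ 1)`
    -- denotes `1#` definitionally.
    ⟦_⟧ : ℤ → Carrier
    ⟦ + n ⟧      = n · 1#
    ⟦ -[1+ n ] ⟧ = - (suc n · 1#)

    +-cancel-- : ∀ x y z → (z + x) - (z + y) ≈ x - y
    +-cancel-- x y z = begin
      (z + x) - (z + y)     ≈⟨ +-cong (+-comm z x) (sym (-‿+-comm z y)) ⟩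
      (x + z) + (- z - y)   ≈⟨ +-assoc x z (- z - y) ⟩
      x + (z + (- z - y))   ≈⟨ +-congˡ (+-assoc z (- z) (- y)) ⟨
      x + ((z - z) - y)     ≈⟨ +-congˡ (+-congʳ (-‿inverseʳ z)) ⟩
      x + (0# - y)          ≈⟨ +-congˡ (+-identityˡ (- y)) ⟩
      x - y                 ∎

    ⊖-homo : ∀ m n → ⟦ m ⊖ n ⟧ ≈ m · 1# - n · 1#
    ⊖-homo m       zero    = sym (trans (+-congˡ -0#≈0#) (+-identityʳ (m · 1#)))
    ⊖-homo zero    (suc n) = sym (+-identityˡ (- (suc n · 1#)))
    ⊖-homo (suc m) (suc n) = begin
      ⟦ suc m ⊖ suc n ⟧               ≡⟨ ≡.cong ⟦_⟧ (ℤ.[1+m]⊖[1+n]≡m⊖n m n) ⟩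
      ⟦ m ⊖ n ⟧                       ≈⟨ ⊖-homo m n ⟩
      m · 1# - n · 1#                 ≈⟨ +-cancel-- (m · 1#) (n · 1#) 1# ⟨
      (1# + m · 1#) - (1# + n · 1#)   ≈⟨ +-cong (1+× m 1#) (-‿cong (1+× n 1#)) ⟨
      suc m · 1# - suc n · 1#         ∎

    neg-homo : ∀ i → ⟦ ℤ.- i ⟧ ≈ - ⟦ i ⟧
    neg-homo (+ zero)  = sym -0#≈0#
    neg-homo (+ suc n) = refl
    neg-homo -[1+ n ]  = sym (-‿involutive (suc n · 1#))

    +-homo : ∀ i j → ⟦ i ℤ.+ j ⟧ ≈ ⟦ i ⟧ + ⟦ j ⟧
    +-homo (+ m)    (+ n)    = ×-homo-+ 1# m n
    +-homo (+ m)    -[1+ n ] = ⊖-homo m (suc n)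
    +-homo -[1+ m ] (+ n)    = trans (⊖-homo n (suc m)) (+-comm (n · 1#) (- (suc m · 1#)))
    +-homo -[1+ m ] -[1+ n ] = begin
      - (suc (suc (m ℕ.+ n)) · 1#)        ≡⟨ ≡.cong (λ k → - (k · 1#)) (ℕ.+-suc (suc m) n) ⟨
      - ((suc m ℕ.+ suc n) · 1#)          ≈⟨ -‿cong (×-homo-+ 1# (suc m) (suc n)) ⟩
      - (suc m · 1# + suc n · 1#)         ≈⟨ -‿+-comm (suc m · 1#) (suc n · 1#) ⟨
      - (suc m · 1#) - (suc n · 1#)       ∎

    -- Integer multiplication is defined by sign and magnitude, so `*-homo` first has to evaluate
    -- `_◃_`.
    pos-◃ : ∀ n → ⟦ Sign.+ ℤ.◃ n ⟧ ≈ n · 1#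
    pos-◃ zero    = refl
    pos-◃ (suc n) = refl

    neg-◃ : ∀ n → ⟦ Sign.- ℤ.◃ n ⟧ ≈ - (n · 1#)
    neg-◃ zero    = sym -0#≈0#
    neg-◃ (suc n) = refl

    *-homo : ∀ i j → ⟦ i ℤ.* j ⟧ ≈ ⟦ i ⟧ * ⟦ j ⟧
    *-homo (+ m)    (+ n)    = trans (pos-◃ (m ℕ.* n)) (×1-homo-* m n)
    *-homo (+ m)    -[1+ n ] = begin
      ⟦ Sign.- ℤ.◃ (m ℕ.* suc n) ⟧     ≈⟨ neg-◃ (m ℕ.* suc n) ⟩
      - ((m ℕ.* suc n) · 1#)           ≈⟨ -‿cong (×1-homo-* m (suc n)) ⟩
      - (m · 1# * suc n · 1#)          ≈⟨ -‿distribʳ-* (m · 1#) (suc n · 1#) ⟩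
      m · 1# * - (suc n · 1#)          ∎
    *-homo -[1+ m ] (+ n)    = begin
      ⟦ Sign.- ℤ.◃ (suc m ℕ.* n) ⟧     ≈⟨ neg-◃ (suc m ℕ.* n) ⟩
      - ((suc m ℕ.* n) · 1#)           ≈⟨ -‿cong (×1-homo-* (suc m) n) ⟩
      - (suc m · 1# * n · 1#)          ≈⟨ -‿distribˡ-* (suc m · 1#) (n · 1#) ⟩
      - (suc m · 1#) * n · 1#          ∎
    *-homo -[1+ m ] -[1+ n ] = begin
      (suc m ℕ.* suc n) · 1#               ≈⟨ ×1-homo-* (suc m) (suc n) ⟩
      suc m · 1# * suc n · 1#              ≈⟨ -‿involutive _ ⟨
      - - (suc m · 1# * suc n · 1#)        ≈⟨ -‿cong (-‿distribʳ-* _ _) ⟩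
      - (suc m · 1# * - (suc n · 1#))      ≈⟨ -‿distribˡ-* _ _ ⟩
      - (suc m · 1#) * - (suc n · 1#)      ∎

    homomorphism : CommutativeRing.rawRing ℤ.+-*-commutativeRing -Raw-AlmostCommutative⟶ fromCommutativeRing R
    homomorphism = record
      { ⟦_⟧    = ⟦_⟧
      ; +-homo = +-homo
      ; *-homo = *-homo
      ; -‿homo = neg-homo
      ; 0-homo = refl
      ; 1-homo = refl
      }

    -- Coefficients are compared in ℤ, whose equality is decidable, and not in the ring, where
    -- equality need not be.
    _≟_ : ∀ i j → Maybe (⟦ i ⟧ ≈ ⟦ j ⟧)
    i ≟ j with i ℤ.≟ j
    ... | yes ≡.refl = just refl
    ... | no _       = nothing

  open import Algebra.Solver.Ring _ _ homomorphism _≟_ public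
    using (Polynomial; solve; _:=_; _:+_; _:*_; _:-_; :-_; con)

  -- Spelled as 1# + 1# and so on, to match the numerals 2# and 4# on the nose.
  :1 :2 :4 : ∀ {n} → Polynomial n
  :1 = con (+ 1)
  :2 = :1 :+ :1
  :4 = :2 :+ :2

-- Sums weighted by binomial coefficients and their reciprocity.

module BinomialSums {c ℓ} (R : CommutativeRing c ℓ) where

  open CommutativeRing R
  open IntegerCoefficients R
  open import Algebra.Properties.CommutativeSemiring.Exp commutativeSemiring
    using (_^_; ^-congˡ; ^-distrib-*)
  open import Algebra.Properties.CommutativeSemiring.Binomial commutativeSemiring
    using () renaming (theorem to binomial-theorem)
  open import Algebra.Properties.Semiring.Mult semiring
    using (×-congʳ; ×-comm-*) renaming (_×_ to _·_)
  open import Algebra.Properties.CommutativeMonoid.Mult +-commutativeMonoid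
    using () renaming (×-distrib-+ to ·-distrib-+)
  open import Algebra.Properties.Semiring.Sum semiring
    using (sum; sum-cong-≋; ∑-distrib-+; *-distribˡ-sum)
  open import Relation.Binary.Reasoning.Setoid setoid

  private
    variable
      n : ℕ
      f g : ℕ → Carrier

  -- Opaque, since a sum over Fin (suc n) would unfold and its summand could no longer be inferred.
  opaque

    ∑C : ℕ → (ℕ → Carrier) → Carrier
    ∑C n f = sum {suc n} λ i → (n C toℕ i) · f (toℕ i)

    ∑C-cong : (∀ k → k ℕ.≤ n → f k ≈ g k) → ∑C n f ≈ ∑C n g
    ∑C-cong {n} eq = sum-cong-≋ {suc n} λ i → ×-congʳ (n C toℕ i) (eq (toℕ i) (ℕ.≤-pred (toℕ<n i)))

    ∑C-+ : ∀ n f g → ∑C n (λ k → f k + g k) ≈ ∑C n f + ∑C n g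
    ∑C-+ n f g = trans (sum-cong-≋ {suc n} λ i → ·-distrib-+ (f (toℕ i)) (g (toℕ i)) (n C toℕ i))
      (∑-distrib-+ {suc n} (λ i → (n C toℕ i) · f (toℕ i)) (λ i → (n C toℕ i) · g (toℕ i)))

    ∑C-* : ∀ n z f → z * ∑C n f ≈ ∑C n (λ k → z * f k)
    ∑C-* n z f = trans (*-distribˡ-sum {suc n} z (λ i → (n C toℕ i) · f (toℕ i)))
      (sum-cong-≋ {suc n} λ i → ×-comm-* (n C toℕ i) z (f (toℕ i)))

    ∑C-^ : ∀ n y z → ∑C n (λ k → y ^ k * z ^ (n ∸ k)) ≈ (y + z) ^ n
    ∑C-^ n y z = sym (binomial-theorem n y z)

  -- Since (-1)ⁿ⁻ᵏ qⁿ⁻ᵏ = (-q)ⁿ⁻ᵏ, multiplying out the two differences leaves four plain binomial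
  -- sums. Writing `- 1# * q` for -q lets `^-distrib-*` apply directly.
  ∑C-expand : ∀ n p q A B κ μ u v →
    ∑C n (λ k → p ^ k * q ^ (n ∸ k) * (κ - (- 1#) ^ (n ∸ k) * μ) * (u * A ^ k - v * B ^ k)) ≈
    κ * u * (p * A + q) ^ n + - (κ * v) * (p * B + q) ^ n
      + (- (μ * u) * (p * A + - 1# * q) ^ n + μ * v * (p * B + - 1# * q) ^ n)
  ∑C-expand n p q A B κ μ u v = begin
    ∑C n (λ k → p ^ k * q ^ (n ∸ k) * (κ - (- 1#) ^ (n ∸ k) * μ) * (u * A ^ k - v * B ^ k))
      ≈⟨ ∑C-cong (λ k _ → termwise k) ⟩
    ∑C n (λ k → κ * u * P A q k + - (κ * v) * P B q k + (- (μ * u) * P A (- 1# * q) k + μ * v * P B (- 1# * q) k))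
      ≈⟨ trans (∑C-+ n _ _) (+-cong (∑C-+ n _ _) (∑C-+ n _ _)) ⟩
    ∑C n (λ k → κ * u * P A q k) + ∑C n (λ k → - (κ * v) * P B q k)
      + (∑C n (λ k → - (μ * u) * P A (- 1# * q) k) + ∑C n (λ k → μ * v * P B (- 1# * q) k))
      ≈⟨ +-cong (+-cong (power (κ * u) A q) (power (- (κ * v)) B q))
                (+-cong (power (- (μ * u)) A (- 1# * q)) (power (μ * v) B (- 1# * q))) ⟩
    κ * u * (p * A + q) ^ n + - (κ * v) * (p * B + q) ^ n
      + (- (μ * u) * (p * A + - 1# * q) ^ n + μ * v * (p * B + - 1# * q) ^ n) ∎
    where
    P : Carrier → Carrier → ℕ → Carrier
    P X y k = (p * X) ^ k * y ^ (n ∸ k)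

    power : ∀ t X y → ∑C n (λ k → t * P X y k) ≈ t * (p * X + y) ^ n
    power t X y = trans (sym (∑C-* n t (P X y))) (*-congˡ (∑C-^ n (p * X) y))

    termwise : ∀ k →
      p ^ k * q ^ (n ∸ k) * (κ - (- 1#) ^ (n ∸ k) * μ) * (u * A ^ k - v * B ^ k) ≈
      κ * u * P A q k + - (κ * v) * P B q k + (- (μ * u) * P A (- 1# * q) k + μ * v * P B (- 1# * q) k)
    termwise k = trans
      (solve 9 (λ P Q E X Y κ μ u v →
          P :* Q :* (κ :- E :* μ) :* (u :* X :- v :* Y) :=
          κ :* u :* (P :* X :* Q) :+ :- (κ :* v) :* (P :* Y :* Q)
            :+ (:- (μ :* u) :* (P :* X :* (E :* Q)) :+ μ :* v :* (P :* Y :* (E :* Q))))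
        refl (p ^ k) (q ^ (n ∸ k)) ((- 1#) ^ (n ∸ k)) (A ^ k) (B ^ k) κ μ u v)
      (sym (+-cong
        (+-cong (*-congˡ (*-congʳ (^-distrib-* p A k))) (*-congˡ (*-congʳ (^-distrib-* p B k))))
        (+-cong (*-congˡ (*-cong (^-distrib-* p A k) (^-distrib-* (- 1#) q (n ∸ k))))
                (*-congˡ (*-cong (^-distrib-* p B k) (^-distrib-* (- 1#) q (n ∸ k)))))))

  -- Both sums expand to
  -- κu (m+q′+q)ⁿ - κv (m-q′+q)ⁿ - μu (m+q′-q)ⁿ + μv (m-q′-q)ⁿ.
  ∑C-reciprocity : ∀ n m p q A B p′ q′ A′ B′ κ μ u v →
    p * A ≈ m + q′ → p * B ≈ m - q′ → p′ * A′ ≈ m + q → p′ * B′ ≈ m - q →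
    ∑C n (λ k → p ^ k * q ^ (n ∸ k) * (κ - (- 1#) ^ (n ∸ k) * μ) * (u * A ^ k - v * B ^ k)) ≈
    ∑C n (λ k → p′ ^ k * q′ ^ (n ∸ k) * (u - (- 1#) ^ (n ∸ k) * v) * (κ * A′ ^ k - μ * B′ ^ k))
  ∑C-reciprocity n m p q A B p′ q′ A′ B′ κ μ u v pA pB p′A′ p′B′ = begin
    ∑C n (λ k → p ^ k * q ^ (n ∸ k) * (κ - (- 1#) ^ (n ∸ k) * μ) * (u * A ^ k - v * B ^ k))
      ≈⟨ ∑C-expand n p q A B κ μ u v ⟩
    κ * u * (p * A + q) ^ n + - (κ * v) * (p * B + q) ^ n
      + (- (μ * u) * (p * A + - 1# * q) ^ n + μ * v * (p * B + - 1# * q) ^ n)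
      ≈⟨ +-cong (+-cong (*-congˡ (^-congˡ n e₁)) (*-congˡ (^-congˡ n e₂)))
                (+-cong (*-congˡ (^-congˡ n e₃)) (*-congˡ (^-congˡ n e₄))) ⟩
    κ * u * (p′ * A′ + q′) ^ n + - (κ * v) * (p′ * A′ + - 1# * q′) ^ n
      + (- (μ * u) * (p′ * B′ + q′) ^ n + μ * v * (p′ * B′ + - 1# * q′) ^ n)
      -- Exchanging (κ, μ) with (u, v) fixes the outer two of the four powers and swaps the middle
      -- two.
      ≈⟨ solve 8 (λ κ μ u v X Y Z W →
           κ :* u :* X :+ :- (κ :* v) :* Y :+ (:- (μ :* u) :* Z :+ μ :* v :* W) :=
           u :* κ :* X :+ :- (u :* μ) :* Z :+ (:- (v :* κ) :* Y :+ v :* μ :* W))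
           refl κ μ u v ((p′ * A′ + q′) ^ n) ((p′ * A′ + - 1# * q′) ^ n)
             ((p′ * B′ + q′) ^ n) ((p′ * B′ + - 1# * q′) ^ n) ⟩
    u * κ * (p′ * A′ + q′) ^ n + - (u * μ) * (p′ * B′ + q′) ^ n
      + (- (v * κ) * (p′ * A′ + - 1# * q′) ^ n + v * μ * (p′ * B′ + - 1# * q′) ^ n)
      ≈⟨ ∑C-expand n p′ q′ A′ B′ u v κ μ ⟨
    ∑C n (λ k → p′ ^ k * q′ ^ (n ∸ k) * (u - (- 1#) ^ (n ∸ k) * v) * (κ * A′ ^ k - μ * B′ ^ k)) ∎
    where
    e₁ : p * A + q ≈ p′ * A′ + q′
    e₁ = trans (+-congʳ pA) (trans
      (solve 3 (λ m q q′ → m :+ q′ :+ q := m :+ q :+ q′) refl m q q′) (+-congʳ (sym p′A′)))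
    e₂ : p * B + q ≈ p′ * A′ + - 1# * q′
    e₂ = trans (+-congʳ pB) (trans
      (solve 3 (λ m q q′ → m :- q′ :+ q := m :+ q :+ :- :1 :* q′) refl m q q′) (+-congʳ (sym p′A′)))
    e₃ : p * A + - 1# * q ≈ p′ * B′ + q′
    e₃ = trans (+-congʳ pA) (trans
      (solve 3 (λ m q q′ → m :+ q′ :+ :- :1 :* q := m :- q :+ q′) refl m q q′) (+-congʳ (sym p′B′)))
    e₄ : p * B + - 1# * q ≈ p′ * B′ + - 1# * q′
    e₄ = trans (+-congʳ pB) (trans
      (solve 3 (λ m q q′ → m :- q′ :+ :- :1 :* q := m :- q :+ :- :1 :* q′) refl m q q′) (+-congʳ (sym p′B′)))

-- Binet formulas for second-order linear recurrences.

module LinearRecurrences {c ℓ} (R : CommutativeRing c ℓ) where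

  open CommutativeRing R
  open IntegerCoefficients R
  open import Algebra.Properties.CommutativeSemiring.Exp commutativeSemiring
    using (_^_; ^-assocʳ)
  open import Relation.Binary.Reasoning.Setoid setoid

  module _ {P Q A B w u v : Carrier} {X : ℕ → Carrier}
    (A² : A * A ≈ P * A + Q) (B² : B * B ≈ P * B + Q)
    (w₀ : w * X 0 ≈ u - v) (w₁ : w * X 1 ≈ u * A - v * B)
    (step : ∀ k → X (suc (suc k)) ≈ P * X (suc k) + Q * X k) where

    -- As A and B are roots of t² = P t + Q, both sides obey the same recurrence, and they agree at
    -- 0 and 1. The weight `w` carries the denominator of Binet's formula, so nothing is divided.
    binet : ∀ k → w * X k ≈ u * A ^ k - v * B ^ k
    binet 0 = trans w₀ (solve 2 (λ u v → u :- v := u :* :1 :- v :* :1) refl u v)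
    binet 1 = trans w₁ (solve 4 (λ A B u v → u :* A :- v :* B := u :* (A :* :1) :- v :* (B :* :1)) refl A B u v)
    binet (suc (suc k)) = begin
      w * X (suc (suc k))
        ≈⟨ *-congˡ (step k) ⟩
      w * (P * X (suc k) + Q * X k)
        ≈⟨ solve 5 (λ w P Q X Y → w :* (P :* X :+ Q :* Y) := P :* (w :* X) :+ Q :* (w :* Y))
             refl w P Q (X (suc k)) (X k) ⟩
      P * (w * X (suc k)) + Q * (w * X k)
        ≈⟨ +-cong (*-congˡ (binet (suc k))) (*-congˡ (binet k)) ⟩
      P * (u * (A * A ^ k) - v * (B * B ^ k)) + Q * (u * A ^ k - v * B ^ k)
        ≈⟨ solve 8 (λ P Q A B u v X Y →
             P :* (u :* (A :* X) :- v :* (B :* Y)) :+ Q :* (u :* X :- v :* Y) :=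
             u :* ((P :* A :+ Q) :* X) :- v :* ((P :* B :+ Q) :* Y))
             refl P Q A B u v (A ^ k) (B ^ k) ⟩
      u * ((P * A + Q) * A ^ k) - v * ((P * B + Q) * B ^ k)
        ≈⟨ +-cong (*-congˡ (*-congʳ A²)) (-‿cong (*-congˡ (*-congʳ B²))) ⟨
      u * ((A * A) * A ^ k) - v * ((B * B) * B ^ k)
        ≈⟨ +-cong (*-congˡ (*-assoc A A (A ^ k))) (-‿cong (*-congˡ (*-assoc B B (B ^ k)))) ⟩
      u * A ^ suc (suc k) - v * B ^ suc (suc k) ∎

  module _ {A B w u v : Carrier} {X : ℕ → Carrier} (wX : ∀ k → w * X k ≈ u * A ^ k - v * B ^ k) where

    -- Even and odd subsequences are again combinations of two k-th powers, the shape that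
    -- `∑C-reciprocity` takes; an odd index passes one factor into each coefficient.
    binet-even : ∀ k → w * X (2 ℕ.* k) ≈ u * (A ^ 2) ^ k - v * (B ^ 2) ^ k
    binet-even k = trans (wX (2 ℕ.* k))
      (sym (+-cong (*-congˡ (^-assocʳ A 2 k)) (-‿cong (*-congˡ (^-assocʳ B 2 k)))))

    binet-odd : ∀ k → w * X (suc (2 ℕ.* k)) ≈ u * A * (A ^ 2) ^ k - v * B * (B ^ 2) ^ k
    binet-odd k = trans (wX (suc (2 ℕ.* k)))
      (sym (+-cong (trans (*-assoc u A _) (*-congˡ (*-congˡ (^-assocʳ A 2 k))))
                   (-‿cong (trans (*-assoc v B _) (*-congˡ (*-congˡ (^-assocʳ B 2 k)))))))

-- Invertible elements.

module Units {c ℓ} (R : CommutativeRing c ℓ) where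

  open CommutativeRing R
  open IntegerCoefficients R
  open import Relation.Binary.Reasoning.Setoid setoid

  Unit : Carrier → Set _
  Unit y = ∃ λ z → z * y ≈ 1#

  unit-* : ∀ {y z} → Unit y → Unit z → Unit (y * z)
  unit-* {y} {z} (y′ , p) (z′ , q) = y′ * z′ , (begin
    y′ * z′ * (y * z)   ≈⟨ solve 4 (λ a b c d → a :* b :* (c :* d) := (a :* c) :* (b :* d)) refl y′ z′ y z ⟩
    (y′ * y) * (z′ * z) ≈⟨ *-cong p q ⟩
    1# * 1#             ≈⟨ *-identityˡ 1# ⟩
    1#                  ∎)

  -- If w′ inverts w, then w′ y inverts z. In this way the square roots inherit invertibility from
  -- the bases that contain them.
  unit-factorʳ : ∀ {w} y z → w ≈ y * z → Unit w → Unit z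
  unit-factorʳ y z w≈yz (w′ , p) = w′ * y , trans (*-assoc w′ y z) (trans (*-congˡ (sym w≈yz)) p)

  unit-cancel : ∀ {w} → Unit w → ∀ {y z} → w * y ≈ w * z → y ≈ z
  unit-cancel {w} (w′ , p) {y} {z} eq = trans (sym (strip y)) (trans (*-congˡ eq) (strip z))
    where
    strip : ∀ t → w′ * (w * t) ≈ t
    strip t = trans (sym (*-assoc w′ w t)) (trans (*-congʳ p) (*-identityˡ t))

-- Clearing negative exponents by weights.

module ScaledSums {c ℓ₁ ℓ₂} (K : HeytingField c ℓ₁ ℓ₂) where

  open HeytingField K using (_#_; #⇒invertible; heytingCommutativeRing)
  open HeytingCommutativeRing heytingCommutativeRing using (commutativeRing) public
  open CommutativeRing commutativeRing
  open Expressions K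
  open BinomialSums commutativeRing public using (∑C; ∑C-reciprocity)
  open Units commutativeRing public
  open IntegerCoefficients commutativeRing
  open import Algebra.Properties.Semiring.Mult semiring using (×-congʳ; ×-comm-*)
  open import Algebra.Properties.Semiring.Sum semiring
    using (sum-cong-≋; *-distribˡ-sum; sum-init-last)
  open import Relation.Binary.Reasoning.Setoid setoid

  inverse-unit : ∀ {y} (y#0 : y # 0#) → inverse y y#0 * y ≈ 1#
  inverse-unit {y} y#0 = trans
    (*-congˡ (solve 1 (λ y → y := y :- con (+ 0)) refl y))
    (proj₁ (proj₂ (#⇒invertible y#0)))

  #⇒unit : ∀ {y} → y # 0# → Unit y
  #⇒unit {y} y#0 = inverse y y#0 , inverse-unit y#0

  *-/ : ∀ y z (y#0 : y # 0#) → y * (z / y [ y#0 ]) ≈ z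
  *-/ y z y#0 = begin
    y * (z * inverse y y#0)   ≈⟨ solve 3 (λ y z i → y :* (z :* i) := z :* (i :* y)) refl y z (inverse y y#0) ⟩
    z * (inverse y y#0 * y)   ≈⟨ *-congˡ (inverse-unit y#0) ⟩
    z * 1#                    ≈⟨ *-identityʳ z ⟩
    z                         ∎

  -- Only m = 0 involves the inverse. One extra factor y makes every exponent m - 1 natural, which
  -- brings the sums within reach of the binomial theorem.
  ^ᶻ-⊖1 : ∀ y (y#0 : y # 0#) m → y * y ^ᶻ m ⊖ 1 [ y#0 ] ≈ y ^ m
  ^ᶻ-⊖1 y y#0 zero    = trans (*-congˡ (*-identityʳ _)) (trans (*-comm y _) (inverse-unit y#0))
  ^ᶻ-⊖1 y y#0 (suc m) = refl

  ⊖-suc : ∀ {k n} → k ℕ.≤ n → n ⊖ suc k ≡ (n ∸ k) ⊖ 1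
  ⊖-suc z≤n                   = ≡.refl
  ⊖-suc (s≤s {k} {n} k≤n)     = ≡.trans (ℤ.[1+m]⊖[1+n]≡m⊖n n (suc k)) (⊖-suc k≤n)

  ^ᶻ-⊖suc : ∀ y (y#0 : y # 0#) {k n} → k ℕ.≤ n → y * y ^ᶻ n ⊖ suc k [ y#0 ] ≈ y ^ (n ∸ k)
  ^ᶻ-⊖suc y y#0 {k} {n} k≤n rewrite ⊖-suc k≤n = ^ᶻ-⊖1 y y#0 (n ∸ k)

  module _ {n : ℕ} {w : Carrier} {f g : ℕ → Carrier} where

    private
      term : ∀ k {y z} → w * y ≈ z → w * ((n C k) · y) ≈ (n C k) · z
      term k {y} eq = trans (×-comm-* (n C k) w y) (×-congʳ (n C k) eq)

    opaque
      unfolding ∑C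

      scale-∑ : (∀ k → k ℕ.≤ n → w * f k ≈ g k) → w * (∑[ 0 ≤ k < suc n ] (n C k) · f k) ≈ ∑C n g
      scale-∑ eq = trans (*-distribˡ-sum {suc n} w (λ i → (n C toℕ i) · f (toℕ i)))
        (sum-cong-≋ {suc n} λ i → term (toℕ i) (eq (toℕ i) (ℕ.≤-pred (toℕ<n i))))

      -- Shifting f by one lets unification find it from the hypothesis.
      scale-∑-from-1 : g 0 ≈ 0# → (∀ k → suc k ℕ.≤ n → w * f k ≈ g (suc k)) →
                       w * (∑[ 1 ≤ k < suc n ] (n C k) · f (k ∸ 1)) ≈ ∑C n g
      scale-∑-from-1 g0 eq = begin
        w * (∑[ 1 ≤ k < suc n ] (n C k) · f (k ∸ 1))
          ≈⟨ *-distribˡ-sum {n} w (λ i → (n C suc (toℕ i)) · f (toℕ i)) ⟩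
        sum {n} (λ i → w * ((n C suc (toℕ i)) · f (toℕ i)))
          ≈⟨ sum-cong-≋ {n} (λ i → term (suc (toℕ i)) (eq (toℕ i) (toℕ<n i))) ⟩
        sum {n} (λ i → (n C suc (toℕ i)) · g (suc (toℕ i)))
          ≈⟨ +-identityˡ _ ⟨
        0# + sum {n} (λ i → (n C suc (toℕ i)) · g (suc (toℕ i)))
          -- `n C 0` computes to 1, so the missing summand is `g 0 + 0#`.
          ≈⟨ +-congʳ (trans (+-identityʳ (g 0)) g0) ⟨
        ∑C n g ∎

      -- For the sum that stops at k = n - 1: since `g n` vanishes, the top index can be added to
      -- reach a full binomial sum.
      scale-∑-below : g n ≈ 0# → (∀ k → k ℕ.< n → w * f k ≈ g k) →
                      w * (∑[ 0 ≤ k < n ] (n C k) · f k) ≈ ∑C n g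
      scale-∑-below gn eq = begin
        w * (∑[ 0 ≤ k < n ] (n C k) · f k)
          ≈⟨ *-distribˡ-sum {n} w (λ i → (n C toℕ i) · f (toℕ i)) ⟩
        sum {n} (λ i → w * ((n C toℕ i) · f (toℕ i)))
          ≈⟨ sum-cong-≋ {n} (λ i → trans (term (toℕ i) (eq (toℕ i) (toℕ<n i)))
               (reflexive (≡.cong h (≡.sym (toℕ-inject₁ i))))) ⟩
        sum {n} (λ i → h (toℕ (inject₁ i)))
          ≈⟨ +-identityʳ _ ⟨
        sum {n} (λ i → h (toℕ (inject₁ i))) + 0#
          ≈⟨ +-congˡ (trans (reflexive (≡.cong h (toℕ-fromℕ n))) (vanish (n C n))) ⟨
        sum {n} (λ i → h (toℕ (inject₁ i))) + h (toℕ (fromℕ n))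
          ≈⟨ sum-init-last {n} (λ i → h (toℕ i)) ⟨
        ∑C n g ∎
        where
        h : ℕ → Carrier
        h k = (n C k) · g k
        vanish : ∀ m → m · g n ≈ 0#
        vanish zero    = refl
        vanish (suc m) = trans (+-cong gn (vanish m)) (+-identityˡ 0#)

  1^ : ∀ k → 1# ^ k ≈ 1#
  1^ zero    = refl
  1^ (suc k) = trans (*-identityˡ (1# ^ k)) (1^ k)

  -- `∑C-reciprocity` expects a k-th power of some p; summands without one get p = 1. The factor η
  -- completes the other power and ζ is the Binet weight.
  scale-term₃ : ∀ {η ζ Y Y′ S S′ P P′} k → η * Y ≈ Y′ → S ≈ S′ → ζ * P ≈ P′ →
                η * ζ * (Y * S * P) ≈ 1# ^ k * Y′ * S′ * P′
  scale-term₃ {η} {ζ} {Y} {Y′} {S} {S′} {P} {P′} k ηY S≈ ζP = begin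
    η * ζ * (Y * S * P)
      ≈⟨ solve 5 (λ η ζ Y S P → η :* ζ :* (Y :* S :* P) := :1 :* (η :* Y) :* S :* (ζ :* P)) refl η ζ Y S P ⟩
    1# * (η * Y) * S * (ζ * P)
      ≈⟨ *-cong (*-cong (*-cong (sym (1^ k)) ηY) S≈) ζP ⟩
    1# ^ k * Y′ * S′ * P′ ∎

  scale-term₄ : ∀ {ξ η ζ X X′ Y Y′ S S′ P P′} → ξ * X ≈ X′ → η * Y ≈ Y′ → S ≈ S′ → ζ * P ≈ P′ →
                ξ * η * ζ * (X * Y * S * P) ≈ X′ * Y′ * S′ * P′
  scale-term₄ {ξ} {η} {ζ} {X} {Y = Y} {S = S} {P = P} ξX ηY S≈ ζP = trans
    (solve 7 (λ ξ η ζ X Y S P → ξ :* η :* ζ :* (X :* Y :* S :* P) := (ξ :* X) :* (η :* Y) :* S :* (ζ :* P))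
      refl ξ η ζ X Y S P)
    (*-cong (*-cong (*-cong ξX ηY) S≈) ζP)

  reweigh : ∀ {w ω S Z} → w ≈ ω → ω * S ≈ Z → w * S ≈ Z
  reweigh w≈ω eq = trans (*-congʳ w≈ω) eq

  -- An outer factor `l` such as x, 2 or 2x is counted into the weight ω of the inner sum.
  prefactor : ∀ {w ω l S Z} → w * l ≈ ω → ω * S ≈ Z → w * (l * S) ≈ Z
  prefactor {w} {l = l} {S} wl eq = trans (sym (*-assoc w l S)) (reweigh wl eq)

  -- The frame of all twelve identities: one weight turns the two sides into reciprocal binomial
  -- sums, and it cancels because it is invertible.
  compare : ∀ {w S S′ Z Z′} → Z ≈ Z′ → Unit w → w * S ≈ Z → w * S′ ≈ Z′ → S ≈ S′
  compare Z≈Z′ unit wS wS′ = unit-cancel unit (trans wS (trans Z≈Z′ (sym wS′)))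

-- Characteristic roots, bases and weights.

module Parameters {ℓ₀ ℓ₁ ℓ₂} (K : HeytingField ℓ₀ ℓ₁ ℓ₂) where

  open HeytingField K using (_#_)
  open ScaledSums K
  open CommutativeRing commutativeRing
  open Expressions K
  open LinearRecurrences commutativeRing
  open IntegerCoefficients commutativeRing
  open import Relation.Binary.Reasoning.Setoid setoid

  private
    -- Spelled the way `t ^ 2` unfolds, so that solved equations match it definitionally.
    :sq : ∀ {n} → Polynomial n → Polynomial n
    :sq t = t :* (t :* :1)

    -- The facts below concern x + t; taking t = -s and t = -r then gives the conjugates β and σ.
    neg-sq : ∀ {t y} → t ^ 2 ≈ y → (- t) ^ 2 ≈ y
    neg-sq {t} = trans (solve 1 (λ t → :sq (:- t) := :sq t) refl t)

    -- The characteristic equation of the Chebyshev recurrences.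
    α-root : ∀ x t → t ^ 2 ≈ x ^ 2 - 1# → (x + t) * (x + t) ≈ 2# * x * (x + t) + - 1#
    α-root x t t² = begin
      (x + t) * (x + t)
        ≈⟨ solve 2 (λ x t → (x :+ t) :* (x :+ t) := :sq t :+ (:2 :* x :* t :+ :sq x)) refl x t ⟩
      t ^ 2 + (2# * x * t + x ^ 2)
        ≈⟨ +-congʳ t² ⟩
      (x ^ 2 - 1#) + (2# * x * t + x ^ 2)
        ≈⟨ solve 2 (λ x t → (:sq x :- :1) :+ (:2 :* x :* t :+ :sq x) :=
             :2 :* x :* (x :+ t) :+ :- :1) refl x t ⟩
      2# * x * (x + t) + - 1# ∎

    α-square : ∀ x t → t ^ 2 ≈ x ^ 2 - 1# → (x + t) ^ 2 ≈ (2# * x ^ 2 - 1#) + 2# * x * t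
    α-square x t t² = begin
      (x + t) ^ 2
        ≈⟨ solve 2 (λ x t → :sq (x :+ t) := :sq t :+ (:2 :* x :* t :+ :sq x)) refl x t ⟩
      t ^ 2 + (2# * x * t + x ^ 2)
        ≈⟨ +-congʳ t² ⟩
      (x ^ 2 - 1#) + (2# * x * t + x ^ 2)
        ≈⟨ solve 2 (λ x t → (:sq x :- :1) :+ (:2 :* x :* t :+ :sq x) :=
             (:2 :* :sq x :- :1) :+ :2 :* x :* t) refl x t ⟩
      (2# * x ^ 2 - 1#) + 2# * x * t ∎

    -- Clearing the factor 4 reduces this to (x + t)² = 2(x² + 2) + 2xt. The centre `m` is a
    -- variable because (x² + 2)/2 occurs once as d x and once as g (2x² - 1).
    ρ-square : ∀ x t τ e m → Unit 2# → t ^ 2 ≈ x ^ 2 + 4# → 2# * τ ≈ x + t → 2# * e ≈ x * t →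
               2# * m ≈ x ^ 2 + 2# → τ ^ 2 ≈ m + e
    ρ-square x t τ e m u2 t² 2τ 2e 2m = unit-cancel (unit-* u2 u2) (begin
      2# * 2# * τ ^ 2
        ≈⟨ solve 1 (λ τ → :2 :* :2 :* :sq τ := (:2 :* τ) :* (:2 :* τ)) refl τ ⟩
      (2# * τ) * (2# * τ)
        ≈⟨ *-cong 2τ 2τ ⟩
      (x + t) * (x + t)
        ≈⟨ solve 2 (λ x t → (x :+ t) :* (x :+ t) := :sq t :+ (:2 :* x :* t :+ :sq x)) refl x t ⟩
      t ^ 2 + (2# * x * t + x ^ 2)
        ≈⟨ +-congʳ t² ⟩
      (x ^ 2 + 4#) + (2# * x * t + x ^ 2)
        ≈⟨ solve 2 (λ x t → (:sq x :+ :4) :+ (:2 :* x :* t :+ :sq x) :=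
             :2 :* (:sq x :+ :2) :+ :2 :* (x :* t)) refl x t ⟩
      2# * (x ^ 2 + 2#) + 2# * (x * t)
        ≈⟨ +-cong (*-congˡ 2m) (*-congˡ 2e) ⟨
      2# * (2# * m) + 2# * (2# * e)
        ≈⟨ solve 2 (λ m e → :2 :* (:2 :* m) :+ :2 :* (:2 :* e) := :2 :* :2 :* (m :+ e)) refl m e ⟩
      2# * 2# * (m + e) ∎)

    -- The characteristic equation of the Fibonacci recurrence, multiplied by 4 to clear the halves.
    ρ-root : ∀ x t τ → Unit 2# → t ^ 2 ≈ x ^ 2 + 4# → 2# * τ ≈ x + t → τ * τ ≈ x * τ + 1#
    ρ-root x t τ u2 t² 2τ = unit-cancel (unit-* u2 u2) (begin
      2# * 2# * (τ * τ)
        ≈⟨ solve 1 (λ τ → :2 :* :2 :* (τ :* τ) := (:2 :* τ) :* (:2 :* τ)) refl τ ⟩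
      (2# * τ) * (2# * τ)
        ≈⟨ *-cong 2τ 2τ ⟩
      (x + t) * (x + t)
        ≈⟨ solve 2 (λ x t → (x :+ t) :* (x :+ t) := :sq t :+ (:2 :* x :* t :+ :sq x)) refl x t ⟩
      t ^ 2 + (2# * x * t + x ^ 2)
        ≈⟨ +-congʳ t² ⟩
      (x ^ 2 + 4#) + (2# * x * t + x ^ 2)
        ≈⟨ solve 2 (λ x t → (:sq x :+ :4) :+ (:2 :* x :* t :+ :sq x) :=
             :2 :* x :* (x :+ t) :+ :4) refl x t ⟩
      2# * x * (x + t) + 4#
        ≈⟨ +-congʳ (*-congˡ 2τ) ⟨
      2# * x * (2# * τ) + 4#
        ≈⟨ solve 2 (λ x τ → :2 :* x :* (:2 :* τ) :+ :4 := :2 :* :2 :* (x :* τ :+ :1)) refl x τ ⟩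
      2# * 2# * (x * τ + 1#) ∎)

    -- Here b = 2(2x² - 1)/x, so bτ = (2x² - 1)(1 + t/x), whose second part is a. Multiplication by
    -- 2x clears the denominators.
    bτ-center : ∀ x t τ a b → Unit 2# → Unit x → 2# * τ ≈ x + t →
                x * a ≈ t * (2# * x ^ 2 - 1#) → x * b ≈ 4# * x ^ 2 - 2# →
                b * τ ≈ (2# * x ^ 2 - 1#) + a
    bτ-center x t τ a b u2 ux 2τ xa xb = unit-cancel (unit-* u2 ux) (begin
      2# * x * (b * τ)
        ≈⟨ solve 3 (λ x b τ → :2 :* x :* (b :* τ) := (x :* b) :* (:2 :* τ)) refl x b τ ⟩
      (x * b) * (2# * τ)
        ≈⟨ *-cong xb 2τ ⟩
      (4# * x ^ 2 - 2#) * (x + t)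
        ≈⟨ solve 2 (λ x t → (:4 :* :sq x :- :2) :* (x :+ t) :=
             :2 :* (t :* (:2 :* :sq x :- :1)) :+ :2 :* x :* (:2 :* :sq x :- :1)) refl x t ⟩
      2# * (t * (2# * x ^ 2 - 1#)) + 2# * x * (2# * x ^ 2 - 1#)
        ≈⟨ +-congʳ (*-congˡ xa) ⟨
      2# * (x * a) + 2# * x * (2# * x ^ 2 - 1#)
        ≈⟨ solve 2 (λ x a → :2 :* (x :* a) :+ :2 :* x :* (:2 :* :sq x :- :1) :=
             :2 :* x :* ((:2 :* :sq x :- :1) :+ a)) refl x a ⟩
      2# * x * ((2# * x ^ 2 - 1#) + a) ∎)

  -- This and the next four bring the sign factors to the form κ - e μ with e = (-1)ⁿ⁻ᵏ. The
  -- products on ρ, σ, α, β are spelled as `binet-odd` produces them.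
  1-e≈1-e*1 : ∀ e → 1# - e ≈ 1# - e * 1#
  1-e≈1-e*1 = solve 1 (λ e → :1 :- e := :1 :- e :* :1) refl

  1+e≈1-e*-1 : ∀ e → 1# + e ≈ 1# - e * - 1#
  1+e≈1-e*-1 = solve 1 (λ e → :1 :+ e := :1 :- e :* :- :1) refl

  ρ-eσ : ∀ ρ σ e → ρ - e * σ ≈ 1# * ρ - e * (1# * σ)
  ρ-eσ = solve 3 (λ ρ σ e → ρ :- e :* σ := :1 :* ρ :- e :* (:1 :* σ)) refl

  α+eβ : ∀ α β e → α + e * β ≈ 1# * α - e * (- 1# * β)
  α+eβ = solve 3 (λ α β e → α :+ e :* β := :1 :* α :- e :* (:- :1 :* β)) refl

  α²-eβ² : ∀ α β e → α ^ 2 - e * β ^ 2 ≈ α * α - e * (β * β)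
  α²-eβ² = solve 3 (λ α β e → :sq α :- e :* :sq β := α :* α :- e :* (β :* β)) refl

  -- The bracket is what `1# * ρ ^ 0 - 1# * σ ^ 0` unfolds to; it reflects F₀ = 0, so that sums over
  -- F may start at k = 1.
  vanishes-at-0 : ∀ y → y * (1# * 1# - 1# * 1#) ≈ 0#
  vanishes-at-0 = solve 1 (λ y → y :* (:1 :* :1 :- :1 :* :1) := con (+ 0)) refl

  -- At k = n the sign factor is 1 - (-1)⁰ = 0.
  vanishes-at-top : ∀ n y z → y * (1# - (- 1#) ^ (n ∸ n) * 1#) * z ≈ 0#
  vanishes-at-top n y z rewrite ℕ.n∸n≡0 n =
    solve 2 (λ y z → y :* (:1 :- :1 :* :1) :* z := con (+ 0)) refl y z

  -- The bases of the identities at a point x.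

  module At (x s r : Carrier) (s² : s ^ 2 ≈ x ^ 2 - 1#) (r² : r ^ 2 ≈ x ^ 2 + 4#)
    (2#0 : 2# # 0#) (x#0 : x # 0#) (2x#0 : 2# * x # 0#)
    (2x²-1#0 : 2# * x ^ 2 - 1# # 0#) (4x²-2#0 : 4# * x ^ 2 - 2# # 0#) where

    α = x + s
    β = x - s
    ρ = (x + r) / 2# [ 2#0 ]
    σ = (x - r) / 2# [ 2#0 ]
    a = (r * (2# * x ^ 2 - 1#)) / x [ x#0 ]
    b = (4# * x ^ 2 - 2#) / x [ x#0 ]
    c = 2# * x * s
    d = (x ^ 2 + 2#) / (2# * x) [ 2x#0 ]
    e = (x * r) / 2# [ 2#0 ]
    f = ((x ^ 2 + 2#) * s) / (2# * x) [ 2x#0 ]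
    g = (x ^ 2 + 2#) / (4# * x ^ 2 - 2#) [ 4x²-2#0 ]
    h = (x * (x ^ 2 + 2#) * s) / (2# * x ^ 2 - 1#) [ 2x²-1#0 ]

    private
      m : Carrier
      m = 2# * x ^ 2 - 1#

      u2 : Unit 2#
      u2 = #⇒unit 2#0

      2ρ : 2# * ρ ≈ x + r
      2ρ = *-/ 2# (x + r) 2#0

      2σ : 2# * σ ≈ x - r
      2σ = *-/ 2# (x - r) 2#0

      2e : 2# * e ≈ x * r
      2e = *-/ 2# (x * r) 2#0

      xa : x * a ≈ r * m
      xa = *-/ x (r * m) x#0

      xb : x * b ≈ 4# * x ^ 2 - 2#
      xb = *-/ x (4# * x ^ 2 - 2#) x#0

      -- Hence d α and d β are d x ± f, as reciprocity requires.
      f≈ds : f ≈ d * s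
      f≈ds = solve 3 (λ y s i → y :* s :* i := y :* i :* s) refl (x ^ 2 + 2#) s (inverse (2# * x) 2x#0)

      -- Hence g α² and g β² are g m ± h. The denominators of g and h are reconciled through 4x² - 2
      -- = 2(2x² - 1).
      h≈gc : h ≈ g * c
      h≈gc = unit-cancel (#⇒unit 4x²-2#0) (begin
        (4# * x ^ 2 - 2#) * h
          ≈⟨ solve 2 (λ x h → (:4 :* :sq x :- :2) :* h := :2 :* ((:2 :* :sq x :- :1) :* h)) refl x h ⟩
        2# * (m * h)
          ≈⟨ *-congˡ (*-/ m (x * (x ^ 2 + 2#) * s) 2x²-1#0) ⟩
        2# * (x * (x ^ 2 + 2#) * s)
          ≈⟨ solve 3 (λ x y s → :2 :* (x :* y :* s) := y :* (:2 :* x :* s)) refl x (x ^ 2 + 2#) s ⟩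
        (x ^ 2 + 2#) * c
          ≈⟨ *-congʳ (*-/ (4# * x ^ 2 - 2#) (x ^ 2 + 2#) 4x²-2#0) ⟨
        (4# * x ^ 2 - 2#) * g * c
          ≈⟨ *-assoc _ g c ⟩
        (4# * x ^ 2 - 2#) * (g * c) ∎)

      α² : α ^ 2 ≈ m + c
      α² = α-square x s s²

      β² : β ^ 2 ≈ m - c
      β² = trans (α-square x (- s) (neg-sq s²))
        (+-congˡ (solve 2 (λ x s → :2 :* x :* :- s := :- (:2 :* x :* s)) refl x s))

      ρ² : ∀ {y} → 2# * y ≈ x ^ 2 + 2# → 1# * ρ ^ 2 ≈ y + e
      ρ² {y} 2y = trans (*-identityˡ _) (ρ-square x r ρ e y u2 r² 2ρ 2e 2y)

      σ² : ∀ {y} → 2# * y ≈ x ^ 2 + 2# → 1# * σ ^ 2 ≈ y - e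
      σ² {y} 2y = trans (*-identityˡ _) (ρ-square x (- r) σ (- e) y u2 (neg-sq r²) 2σ
        (trans (solve 1 (λ e → :2 :* :- e := :- (:2 :* e)) refl e) (trans (-‿cong 2e)
          (solve 2 (λ x r → :- (x :* r) := x :* :- r) refl x r))) 2y)

      2dx : 2# * (d * x) ≈ x ^ 2 + 2#
      2dx = trans (solve 2 (λ x d → :2 :* (d :* x) := :2 :* x :* d) refl x d)
        (*-/ (2# * x) (x ^ 2 + 2#) 2x#0)

      2gm : 2# * (g * m) ≈ x ^ 2 + 2#
      2gm = trans (solve 2 (λ x g → :2 :* (g :* (:2 :* :sq x :- :1)) := (:4 :* :sq x :- :2) :* g) refl x g)
        (*-/ (4# * x ^ 2 - 2#) (x ^ 2 + 2#) 4x²-2#0)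

    -- The coefficient v = -1 fits the sum αᵏ + βᵏ to the difference shape of `binet`.
    2T≈ : ∀ k → 2# * T k x ≈ 1# * α ^ k - - 1# * β ^ k
    2T≈ = binet {X = λ k → T k x} (α-root x s s²) (α-root x (- s) (neg-sq s²))
      (solve 0 (:2 :* :1 := :1 :- :- :1) refl)
      (solve 2 (λ x s → :2 :* x := :1 :* (x :+ s) :- :- :1 :* (x :- s)) refl x s)
      (λ k → solve 3 (λ x y z → :2 :* x :* y :- z := :2 :* x :* y :+ :- :1 :* z) refl x (T (suc k) x) (T k x))

    -- Binet's denominator is α - β = 2s, and its exponent k + 1 leaves one factor α or β in the
    -- coefficients.
    2sU≈ : ∀ k → 2# * s * U k x ≈ α * α ^ k - β * β ^ k
    2sU≈ = binet {X = λ k → U k x} (α-root x s s²) (α-root x (- s) (neg-sq s²))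
      (solve 2 (λ x s → :2 :* s :* :1 := (x :+ s) :- (x :- s)) refl x s)
      (solve 2 (λ x s → :2 :* s :* (:2 :* x) := (x :+ s) :* (x :+ s) :- (x :- s) :* (x :- s)) refl x s)
      (λ k → solve 3 (λ x y z → :2 :* x :* y :- z := :2 :* x :* y :+ :- :1 :* z) refl x (U (suc k) x) (U k x))

    rF≈ : ∀ k → r * F k x ≈ 1# * ρ ^ k - 1# * σ ^ k
    rF≈ = binet {X = λ k → F k x}
      (ρ-root x r ρ u2 r² 2ρ) (ρ-root x (- r) σ u2 (neg-sq r²) 2σ)
      (solve 1 (λ r → r :* con (+ 0) := :1 :- :1) refl r)
      (unit-cancel u2 (begin
        2# * (r * 1#)
          ≈⟨ solve 2 (λ x r → :2 :* (r :* :1) := (x :+ r) :- (x :- r)) refl x r ⟩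
        (x + r) - (x - r)
          ≈⟨ +-cong 2ρ (-‿cong 2σ) ⟨
        2# * ρ - 2# * σ
          ≈⟨ solve 2 (λ ρ σ → :2 :* ρ :- :2 :* σ := :2 :* (:1 :* ρ :- :1 :* σ)) refl ρ σ ⟩
        2# * (1# * ρ - 1# * σ) ∎))
      (λ k → solve 3 (λ x y z → x :* y :+ z := x :* y :+ :1 :* z) refl x (F (suc k) x) (F k x))

    -- The centre is 2x² - 1, with offset c for α² and β² and offset a for b ρ and b σ.
    reciprocity-ab : ∀ n u v →
      ∑C n (λ k → 1# ^ k * a ^ (n ∸ k) * (1# - (- 1#) ^ (n ∸ k) * 1#) * (u * (α ^ 2) ^ k - v * (β ^ 2) ^ k)) ≈
      ∑C n (λ k → b ^ k * c ^ (n ∸ k) * (u - (- 1#) ^ (n ∸ k) * v) * (1# * ρ ^ k - 1# * σ ^ k))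
    reciprocity-ab n u v = ∑C-reciprocity n m 1# a (α ^ 2) (β ^ 2) b c ρ σ 1# 1# u v
      (trans (*-identityˡ _) α²) (trans (*-identityˡ _) β²)
      (bτ-center x r ρ a b u2 (#⇒unit x#0) 2ρ xa xb)
      (bτ-center x (- r) σ (- a) b u2 (#⇒unit x#0) 2σ
        (trans (solve 2 (λ x a → x :* :- a := :- (x :* a)) refl x a) (trans (-‿cong xa)
          (solve 2 (λ r m → :- (r :* m) := :- r :* m) refl r m))) xb)

    -- The centre is d x = (x² + 2)/2, with offset f for d α and d β and offset e for ρ² and σ².
    reciprocity-def : ∀ n κ μ u v →
      ∑C n (λ k → d ^ k * e ^ (n ∸ k) * (κ - (- 1#) ^ (n ∸ k) * μ) * (u * α ^ k - v * β ^ k)) ≈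
      ∑C n (λ k → 1# ^ k * f ^ (n ∸ k) * (u - (- 1#) ^ (n ∸ k) * v) * (κ * (ρ ^ 2) ^ k - μ * (σ ^ 2) ^ k))
    reciprocity-def n κ μ u v = ∑C-reciprocity n (d * x) d e α β 1# f (ρ ^ 2) (σ ^ 2) κ μ u v
      (trans (distribˡ d x s) (+-congˡ (sym f≈ds)))
      (trans (solve 3 (λ d x s → d :* (x :- s) := d :* x :- d :* s) refl d x s)
        (+-congˡ (-‿cong (sym f≈ds))))
      (ρ² 2dx) (σ² 2dx)

    -- The centre g m is again (x² + 2)/2, now with offset h for g α² and g β².
    reciprocity-geh : ∀ n κ μ u v →
      ∑C n (λ k → g ^ k * e ^ (n ∸ k) * (κ - (- 1#) ^ (n ∸ k) * μ) * (u * (α ^ 2) ^ k - v * (β ^ 2) ^ k)) ≈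
      ∑C n (λ k → 1# ^ k * h ^ (n ∸ k) * (u - (- 1#) ^ (n ∸ k) * v) * (κ * (ρ ^ 2) ^ k - μ * (σ ^ 2) ^ k))
    reciprocity-geh n κ μ u v = ∑C-reciprocity n (g * m) g e (α ^ 2) (β ^ 2) 1# h (ρ ^ 2) (σ ^ 2) κ μ u v
      (trans (*-congˡ α²) (trans (distribˡ g m c) (+-congˡ (sym h≈gc))))
      (trans (*-congˡ β²) (trans (solve 3 (λ g m c → g :* (m :- c) := g :* m :- g :* c) refl g m c)
        (+-congˡ (-‿cong (sym h≈gc)))))
      (ρ² 2gm) (σ² 2gm)

    -- Equality of the weights on the two sides.

    br≈2a : b * r ≈ 2# * a
    br≈2a = unit-cancel (#⇒unit x#0) (begin
      x * (b * r)             ≈⟨ *-assoc x b r ⟨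
      x * b * r               ≈⟨ *-congʳ xb ⟩
      (4# * x ^ 2 - 2#) * r   ≈⟨ solve 2 (λ x r → (:4 :* :sq x :- :2) :* r := :2 :* (r :* (:2 :* :sq x :- :1))) refl x r ⟩
      2# * (r * m)            ≈⟨ *-congˡ xa ⟨
      2# * (x * a)            ≈⟨ solve 2 (λ x a → :2 :* (x :* a) := x :* (:2 :* a)) refl x a ⟩
      x * (2# * a)            ∎)

    -- On the left `a` completes aⁿ⁻ᵏ and 2 belongs to T; on the right `b` completes bᵏ, `1#` leaves
    -- cⁿ⁻ᵏ alone and `r` belongs to F.
    weight-T-ab : a * 2# ≈ b * 1# * r
    weight-T-ab = trans (*-comm a 2#) (trans (sym br≈2a) (*-congʳ (sym (*-identityʳ b))))

    -- Now 2s belongs to U, `c` completes cⁿ⁻ᵏ, and 2x is the outer factor of the right-hand side.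
    weight-U-ab : a * (2# * s) * (2# * x) ≈ b * c * r
    weight-U-ab = begin
      a * (2# * s) * (2# * x) ≈⟨ solve 3 (λ a s x → a :* (:2 :* s) :* (:2 :* x) := :2 :* a :* (:2 :* x :* s)) refl a s x ⟩
      2# * a * c              ≈⟨ *-congʳ br≈2a ⟨
      b * r * c               ≈⟨ solve 3 (λ b r c → b :* r :* c := b :* c :* r) refl b r c ⟩
      b * c * r               ∎

    -- Shared by the four T identities with base e; x is the outer factor of their left-hand sides.
    weight-T-e : r * x ≈ 1# * e * 2#
    weight-T-e = trans (*-comm r x) (trans (sym 2e) (solve 1 (λ e → :2 :* e := :1 :* e :* :2) refl e))

    weight-U-def : f * r * x ≈ d * e * (2# * s)
    weight-U-def = begin
      f * r * x           ≈⟨ *-assoc f r x ⟩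
      f * (r * x)         ≈⟨ *-cong f≈ds weight-T-e ⟩
      d * s * (1# * e * 2#) ≈⟨ solve 3 (λ d s e → d :* s :* (:1 :* e :* :2) := d :* e :* (:2 :* s)) refl d s e ⟩
      d * e * (2# * s)    ∎

    weight-U-geh : g * e * (2# * s) * 2# ≈ h * r
    weight-U-geh = begin
      g * e * (2# * s) * 2#   ≈⟨ solve 3 (λ g e s → g :* e :* (:2 :* s) :* :2 := g :* :2 :* s :* (:2 :* e)) refl g e s ⟩
      g * 2# * s * (2# * e)   ≈⟨ *-congˡ 2e ⟩
      g * 2# * s * (x * r)    ≈⟨ solve 4 (λ g s x r → g :* :2 :* s :* (x :* r) := g :* (:2 :* x :* s) :* r) refl g s x r ⟩
      g * c * r               ≈⟨ *-congʳ h≈gc ⟨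
      h * r                   ∎

    -- The root s is a factor of c; likewise r is a factor of 2e in `unit-r`.
    unit-2s : c # 0# → Unit (2# * s)
    unit-2s c#0 = unit-* u2 (unit-factorʳ (2# * x) s refl (#⇒unit c#0))

    unit-r : e # 0# → Unit r
    unit-r e#0 = unit-factorʳ x r 2e (unit-* u2 (#⇒unit e#0))

-- The twelve identities.

open import Defs

theorem8 :
  (n : ℕ) (x √x²-1 √x²+4 : ℂ) →
  √x²-1 ^ 2 ≈ x ^ 2 - 1# →
  √x²+4 ^ 2 ≈ x ^ 2 + 4# →
  -- the denominators (the constant denominator 2 is covered by 2#0)
  (x#0 : x # 0#) →
  (2x#0 : 2# * x # 0#) →
  (2x²-1#0 : 2# * x ^ 2 - 1# # 0#) →
  (4x²-2#0 : 4# * x ^ 2 - 2# # 0#) →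
  let
    α = x + √x²-1
    β = x - √x²-1
    ρ = (x + √x²+4) / 2# [ 2#0 ]
    σ = (x - √x²+4) / 2# [ 2#0 ]
    a = (√x²+4 * (2# * x ^ 2 - 1#)) / x [ x#0 ]
    b = (4# * x ^ 2 - 2#) / x [ x#0 ]
    c = 2# * x * √x²-1
    d = (x ^ 2 + 2#) / (2# * x) [ 2x#0 ]
    e = (x * √x²+4) / 2# [ 2#0 ]
    f = ((x ^ 2 + 2#) * √x²-1) / (2# * x) [ 2x#0 ]
    g = (x ^ 2 + 2#) / (4# * x ^ 2 - 2#) [ 4x²-2#0 ]
    h = (x * (x ^ 2 + 2#) * √x²-1) / (2# * x ^ 2 - 1#) [ 2x²-1#0 ]
  in
  -- the bases that are raised to a negative power
  (a#0 : a # 0#) →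
  (c#0 : c # 0#) →
  (d#0 : d # 0#) →
  (e#0 : e # 0#) →
  (f#0 : f # 0#) →
  (g#0 : g # 0#) →
  (h#0 : h # 0#) →
  -- (1)
  ( (∑[ 0 ≤ k < n ] (n C k) · (a ^ (n ∸ k ∸ 1) * (1# - (- 1#) ^ (n ∸ k)) * T (2 ℕ.* k) x))
    ≈
    (∑[ 1 ≤ k < suc n ] (n C k) · (b ^ (k ∸ 1) * c ^ (n ∸ k) * (1# + (- 1#) ^ (n ∸ k)) * F k x))
  ) ×
  -- (2)
  ( (∑[ 0 ≤ k < suc n ] (n C k) · (a ^ᶻ n ⊖ suc k [ a#0 ] * (1# - (- 1#) ^ (n ∸ k)) * U (2 ℕ.* k) x))
    ≈
    2# * x * (∑[ 1 ≤ k < suc n ] (n C k) · (b ^ (k ∸ 1) * c ^ᶻ n ⊖ suc k [ c#0 ] * (α - (- 1#) ^ (n ∸ k) * β) * F k x))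
  ) ×
  -- (3)
  ( (∑[ 0 ≤ k < suc n ] (n C k) · (a ^ᶻ n ⊖ suc k [ a#0 ] * (1# - (- 1#) ^ (n ∸ k)) * T (suc (2 ℕ.* k)) x))
    ≈
    (∑[ 1 ≤ k < suc n ] (n C k) · (b ^ (k ∸ 1) * c ^ (n ∸ k) * (α + (- 1#) ^ (n ∸ k) * β) * F k x))
  ) ×
  -- (4)
  ( (∑[ 0 ≤ k < suc n ] (n C k) · (a ^ᶻ n ⊖ suc k [ a#0 ] * (1# - (- 1#) ^ (n ∸ k)) * U (suc (2 ℕ.* k)) x))
    ≈
    2# * x * (∑[ 1 ≤ k < suc n ] (n C k) · (b ^ (k ∸ 1) * c ^ᶻ n ⊖ suc k [ c#0 ] * (α ^ 2 - (- 1#) ^ (n ∸ k) * β ^ 2) * F k x))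
  ) ×
  -- (5)
  ( x * (∑[ 0 ≤ k < suc n ] (n C k) · (d ^ k * e ^ᶻ n ⊖ suc k [ e#0 ] * (ρ - (- 1#) ^ (n ∸ k) * σ) * T k x))
    ≈
    (∑[ 0 ≤ k < suc n ] (n C k) · (f ^ (n ∸ k) * (1# + (- 1#) ^ (n ∸ k)) * F (suc (2 ℕ.* k)) x))
  ) ×
  -- (6)
  ( x * (∑[ 0 ≤ k < suc n ] (n C k) · (d ^ᶻ k ⊖ 1 [ d#0 ] * e ^ᶻ n ⊖ suc k [ e#0 ] * (ρ - (- 1#) ^ (n ∸ k) * σ) * U k x))
    ≈
    (∑[ 0 ≤ k < suc n ] (n C k) · (f ^ᶻ n ⊖ suc k [ f#0 ] * (α - (- 1#) ^ (n ∸ k) * β) * F (suc (2 ℕ.* k)) x))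
  ) ×
  -- (7)
  ( x * (∑[ 0 ≤ k < suc n ] (n C k) · (d ^ k * e ^ᶻ n ⊖ suc k [ e#0 ] * (1# - (- 1#) ^ (n ∸ k)) * T k x))
    ≈
    (∑[ 1 ≤ k < suc n ] (n C k) · (f ^ (n ∸ k) * (1# + (- 1#) ^ (n ∸ k)) * F (2 ℕ.* k) x))
  ) ×
  -- (8)
  ( x * (∑[ 0 ≤ k < suc n ] (n C k) · (d ^ᶻ k ⊖ 1 [ d#0 ] * e ^ᶻ n ⊖ suc k [ e#0 ] * (1# - (- 1#) ^ (n ∸ k)) * U k x))
    ≈
    (∑[ 0 ≤ k < suc n ] (n C k) · (f ^ᶻ n ⊖ suc k [ f#0 ] * (α - (- 1#) ^ (n ∸ k) * β) * F (2 ℕ.* k) x))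
  ) ×
  -- (9)
  ( x * (∑[ 0 ≤ k < suc n ] (n C k) · (g ^ k * e ^ᶻ n ⊖ suc k [ e#0 ] * (1# - (- 1#) ^ (n ∸ k)) * T (suc (2 ℕ.* k)) x))
    ≈
    (∑[ 0 ≤ k < suc n ] (n C k) · (h ^ (n ∸ k) * (α + (- 1#) ^ (n ∸ k) * β) * F (2 ℕ.* k) x))
  ) ×
  -- (10)
  ( (∑[ 0 ≤ k < suc n ] (n C k) · (g ^ᶻ k ⊖ 1 [ g#0 ] * e ^ᶻ n ⊖ suc k [ e#0 ] * (1# - (- 1#) ^ (n ∸ k)) * U (suc (2 ℕ.* k)) x))
    ≈
    2# * (∑[ 0 ≤ k < suc n ] (n C k) · (h ^ᶻ n ⊖ suc k [ h#0 ] * (α ^ 2 - (- 1#) ^ (n ∸ k) * β ^ 2) * F (2 ℕ.* k) x))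
  ) ×
  -- (11)
  ( x * (∑[ 0 ≤ k < suc n ] (n C k) · (g ^ k * e ^ᶻ n ⊖ suc k [ e#0 ] * (ρ - (- 1#) ^ (n ∸ k) * σ) * T (2 ℕ.* k) x))
    ≈
    (∑[ 0 ≤ k < suc n ] (n C k) · (h ^ (n ∸ k) * (1# + (- 1#) ^ (n ∸ k)) * F (suc (2 ℕ.* k)) x))
  ) ×
  -- (12)
  ( (∑[ 0 ≤ k < suc n ] (n C k) · (g ^ᶻ k ⊖ 1 [ g#0 ] * e ^ᶻ n ⊖ suc k [ e#0 ] * (ρ - (- 1#) ^ (n ∸ k) * σ) * U (2 ℕ.* k) x))
    ≈
    2# * (∑[ 0 ≤ k < suc n ] (n C k) · (h ^ᶻ n ⊖ suc k [ h#0 ] * (α - (- 1#) ^ (n ∸ k) * β) * F (suc (2 ℕ.* k)) x))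
  )
theorem8 n x s r s² r² x#0 2x#0 2x²-1#0 4x²-2#0 a#0 c#0 d#0 e#0 f#0 g#0 h#0 =
  -- In the first four identities (u, v) is (1, -1), (α, β), (α, -β), (α², β²), for T₂ₖ, U₂ₖ, T₂ₖ₊₁,
  -- U₂ₖ₊₁ in turn; κ = μ = 1 belongs to Fₖ.
  compare (reciprocity-ab n 1# (- 1#)) u-a2
    (scale-∑-below (vanishes-at-top n _ _) λ k k<n →
      scale-term₃ k (a^ k<n) (1-e≈1-e*1 _) (T-even k))
    (reweigh weight-T-ab (scale-∑-from-1 (vanishes-at-0 _) λ k _ →
      -- Here k is the summation index minus one, so `b * b ^ k` is already the full power of b.
      scale-term₄ refl (*-identityˡ _) (1+e≈1-e*-1 _) (rF≈ (suc k)))) ,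
  compare (reciprocity-ab n α β) u-a2s
    (scale-∑ λ k k≤n → scale-term₃ k (^ᶻ-⊖suc a a#0 k≤n) (1-e≈1-e*1 _) (U-even k))
    (prefactor weight-U-ab (scale-∑-from-1 (vanishes-at-0 _) λ k k<n →
      scale-term₄ refl (^ᶻ-⊖suc c c#0 k<n) refl (rF≈ (suc k)))) ,
  compare (reciprocity-ab n (1# * α) (- 1# * β)) u-a2
    (scale-∑ λ k k≤n → scale-term₃ k (^ᶻ-⊖suc a a#0 k≤n) (1-e≈1-e*1 _) (T-odd k))
    (reweigh weight-T-ab (scale-∑-from-1 (vanishes-at-0 _) λ k _ →
      scale-term₄ refl (*-identityˡ _) (α+eβ α β _) (rF≈ (suc k)))) ,
  compare (reciprocity-ab n (α * α) (β * β)) u-a2s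
    (scale-∑ λ k k≤n → scale-term₃ k (^ᶻ-⊖suc a a#0 k≤n) (1-e≈1-e*1 _) (U-odd k))
    (prefactor weight-U-ab (scale-∑-from-1 (vanishes-at-0 _) λ k k<n →
      scale-term₄ refl (^ᶻ-⊖suc c c#0 k<n) (α²-eβ² α β _) (rF≈ (suc k)))) ,
  -- In the next four (κ, μ) is (ρ, σ) for F₂ₖ₊₁ and (1, 1) for F₂ₖ, while (u, v) is (1, -1) for Tₖ
  -- and (α, β) for Uₖ.
  compare (reciprocity-def n (1# * ρ) (1# * σ) 1# (- 1#)) u-r
    (prefactor weight-T-e (scale-∑ λ k k≤n →
      scale-term₄ (*-identityˡ _) (^ᶻ-⊖suc e e#0 k≤n) (ρ-eσ ρ σ _) (2T≈ k)))
    -- The power of f is already complete, so the weight is 1 times the Binet weight r.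
    (reweigh r≈1*r (scale-∑ λ k _ →
      scale-term₃ k (*-identityˡ _) (1+e≈1-e*-1 _) (F-odd k))) ,
  compare (reciprocity-def n (1# * ρ) (1# * σ) α β) u-fr
    (prefactor weight-U-def (scale-∑ λ k k≤n →
      scale-term₄ (^ᶻ-⊖1 d d#0 k) (^ᶻ-⊖suc e e#0 k≤n) (ρ-eσ ρ σ _) (2sU≈ k)))
    (scale-∑ λ k k≤n → scale-term₃ k (^ᶻ-⊖suc f f#0 k≤n) refl (F-odd k)) ,
  compare (reciprocity-def n 1# 1# 1# (- 1#)) u-r
    (prefactor weight-T-e (scale-∑ λ k k≤n →
      scale-term₄ (*-identityˡ _) (^ᶻ-⊖suc e e#0 k≤n) (1-e≈1-e*1 _) (2T≈ k)))
    (reweigh r≈1*r (scale-∑-from-1 (vanishes-at-0 _) λ k _ →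
      scale-term₃ (suc k) (*-identityˡ _) (1+e≈1-e*-1 _) (F-even (suc k)))) ,
  compare (reciprocity-def n 1# 1# α β) u-fr
    (prefactor weight-U-def (scale-∑ λ k k≤n →
      scale-term₄ (^ᶻ-⊖1 d d#0 k) (^ᶻ-⊖suc e e#0 k≤n) (1-e≈1-e*1 _) (2sU≈ k)))
    (scale-∑ λ k k≤n → scale-term₃ k (^ᶻ-⊖suc f f#0 k≤n) refl (F-even k)) ,
  -- In the last four the indices are doubled on both sides: (u, v) is chosen as in the first four
  -- identities and (κ, μ) as in the middle four.
  compare (reciprocity-geh n 1# 1# (1# * α) (- 1# * β)) u-r
    (prefactor weight-T-e (scale-∑ λ k k≤n →
      scale-term₄ (*-identityˡ _) (^ᶻ-⊖suc e e#0 k≤n) (1-e≈1-e*1 _) (T-odd k)))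
    (reweigh r≈1*r (scale-∑ λ k _ →
      scale-term₃ k (*-identityˡ _) (α+eβ α β _) (F-even k))) ,
  compare (reciprocity-geh n 1# 1# (α * α) (β * β)) u-ge2s
    (scale-∑ λ k k≤n →
      scale-term₄ (^ᶻ-⊖1 g g#0 k) (^ᶻ-⊖suc e e#0 k≤n) (1-e≈1-e*1 _) (U-odd k))
    (prefactor weight-U-geh (scale-∑ λ k k≤n →
      scale-term₃ k (^ᶻ-⊖suc h h#0 k≤n) (α²-eβ² α β _) (F-even k))) ,
  compare (reciprocity-geh n (1# * ρ) (1# * σ) 1# (- 1#)) u-r
    (prefactor weight-T-e (scale-∑ λ k k≤n →
      scale-term₄ (*-identityˡ _) (^ᶻ-⊖suc e e#0 k≤n) (ρ-eσ ρ σ _) (T-even k)))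
    (reweigh r≈1*r (scale-∑ λ k _ →
      scale-term₃ k (*-identityˡ _) (1+e≈1-e*-1 _) (F-odd k))) ,
  compare (reciprocity-geh n (1# * ρ) (1# * σ) α β) u-ge2s
    (scale-∑ λ k k≤n →
      scale-term₄ (^ᶻ-⊖1 g g#0 k) (^ᶻ-⊖suc e e#0 k≤n) (ρ-eσ ρ σ _) (U-even k))
    (prefactor weight-U-geh (scale-∑ λ k k≤n →
      scale-term₃ k (^ᶻ-⊖suc h h#0 k≤n) refl (F-odd k)))
  where
  open ScaledSums ℂ-heytingField
  open Parameters ℂ-heytingField
  open At x s r s² r² 2#0 x#0 2x#0 2x²-1#0 4x²-2#0
  open CommutativeRing commutativeRing using (refl; sym; trans; reflexive; *-identityˡ)
  open LinearRecurrences commutativeRing using (binet-even; binet-odd)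

  T-even = binet-even {X = λ k → T k x} 2T≈
  T-odd = binet-odd {X = λ k → T k x} 2T≈
  U-even = binet-even {X = λ k → U k x} 2sU≈
  U-odd = binet-odd {X = λ k → U k x} 2sU≈
  F-even = binet-even {X = λ k → F k x} rF≈
  F-odd = binet-odd {X = λ k → F k x} rF≈

  u-r = unit-r e#0
  u-a2 = unit-* (#⇒unit a#0) (#⇒unit 2#0)
  u-a2s = unit-* (#⇒unit a#0) (unit-2s c#0)
  u-fr = unit-* (#⇒unit f#0) u-r
  u-ge2s = unit-* (unit-* (#⇒unit g#0) (#⇒unit e#0)) (unit-2s c#0)
  r≈1*r = sym (*-identityˡ r)

  -- For k < n the truncated exponent n - k - 1 is exact, so the first identity involves only
  -- natural powers of a.
  a^ : ∀ {k} → k ℕ.< n → a * a ^ (n ∸ k ∸ 1) ≈ a ^ (n ∸ k)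
  a^ {k} k<n = reflexive (≡.cong (a ^_) (≡.trans (≡.cong suc (ℕ.∸-+-assoc n k 1))
    (≡.trans (≡.cong (λ j → suc (n ∸ j)) (ℕ.+-comm k 1)) (≡.sym (ℕ.+-∸-assoc 1 k<n)))))
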